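{- Let $k \geq 2$ be an integer and let $G$ be a finite bipartite graph of order $n$ and girth $g$ with $|E(G)| \geq 4\left\lceil \frac{2(k-1)}{g-2} \right\rceil n^{1+1/k}$. Then $G$ contains a cycle of length $2k$.
   Context: The girth of $G$ is the length of a shortest cycle in $G$. -}

module Defs where

open import Data.Nat using (ℕ; zero; suc; _+_; _*_; _∸_; _^_; _≤_; _<_; _≥_)
open import Data.Nat.DivMod using (_/_)
open import Data.Bool using (Bool; true; false; if_then_else_)
open import Data.Fin using (Fin; toℕ)
open import Data.List using (List; map; allFin)
open import Data.Nat.ListAction using (sum)
open import Data.Product using (Σ; _×_)
open import Data.Sum using (_⊎_)
open import Relation.Binary.PropositionalEquality using (_≡_; _≢_)
open import Relation.Nullary.Decidable using (⌊_⌋)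
open import Function.Definitions using (Injective)

record Graph (n : ℕ) : Set where
  field
    adj     : Fin n → Fin n → Bool
    sym     : ∀ u v → adj u v ≡ adj v u
    irrefl  : ∀ v → adj v v ≡ false

open Graph public

Adj : ∀ {n} → Graph n → Fin n → Fin n → Set
Adj G u v = adj G u v ≡ true

edgeCount : ∀ {n} → Graph n → ℕ
edgeCount {n} G =
  sum (map (λ i → sum (map (λ j →
        if ⌊ toℕ i Data.Nat.<? toℕ j ⌋ then (if adj G i j then 1 else 0) else 0)
      (allFin n))) (allFin n))

Bipartite : ∀ {n} → Graph n → Set
Bipartite {n} G = Σ (Fin n → Bool) λ col → ∀ u v → Adj G u v → col u ≢ col v

HasCycle : ∀ {n} → Graph n → ℕ → Set
HasCycle {n} G m =
  (3 ≤ m) × Σ (Fin m → Fin n) λ c →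
    Injective _≡_ _≡_ c ×
    (∀ i j → (toℕ j ≡ suc (toℕ i) ⊎ (toℕ i ≡ m ∸ 1 × toℕ j ≡ 0)) → Adj G (c i) (c j))

Girth : ∀ {n} → Graph n → ℕ → Set
Girth G g = HasCycle G g × (∀ m → m < g → HasCycle G m → Data.Empty.⊥)
  where import Data.Empty

-- ceiling of a / b for b > 0 (value at b = 0 is irrelevant, set to 0)
⌈_/_⌉ : ℕ → ℕ → ℕ
⌈ a / zero ⌉ = 0
⌈ a / suc b ⌉ = (a + b) / suc b

module Submission where

-- Pass to a subgraph H of minimum degree at least e/n, where e counts the edges, and to its distance layers L₀, L₁, …
-- around some root. With r = ⌈2(k-1)/(g-2)⌉, if H has no 2k-cycle then at most r(|L_t| + |L_{t+1}|) edges join L_t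
-- to L_{t+1} whenever t < k; with the minimum degree this gives e|L_t| ≤ 4rn|L_{t+1}|, hence n ≤ |L_k|, impossible.
--
-- For the sparseness with r ≥ 2, a denser pair of layers would contain a subgraph of minimum degree above r and hence,
-- because of the girth, a cycle C of length at least 2k with a chord. Colour the vertices of C in L_t by their
-- ancestors in L_{t-h}. If two of them differ in colour, share their ancestor in L_{t-h-1}, and are joined inside the
-- pair of layers by a path of length 2(k-h-1), then the two tree branches complete this path to a 2k-cycle. By the
-- lemma of Bondy and Simonovits on paths in a cycle with a chord, such a path exists unless the colouring is constant.
-- Descending from h = t (every ancestor is the root) to h = 0 (every vertex is its own ancestor) gives a contradiction.
-- For r = 1 the girth is at least 2k, so every vertex of L_{t+1} has a single neighbour in L_t.

open import Defs
open import Algebra.Properties.Semiring.Sum as Sum using ()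
open import Data.Bool as Bool using (Bool; true; false; not; _∧_; _∨_; if_then_else_)
import Data.Bool.Properties as Bool
open import Data.Bool.Properties using (not-involutive; ¬-not; ∧-comm; ∨-comm)
open import Data.Empty using (⊥)
open import Data.Fin using (Fin; zero; suc; toℕ; fromℕ<)
import Data.Fin.Properties as Fin
open import Data.Fin.Properties using
  (_≟_; all?; any?; pigeonhole; injective⇒≤; toℕ-injective; toℕ-fromℕ<; fromℕ<-injective; toℕ<n)
open import Data.List as List using (List; []; _∷_; _++_; applyUpTo; applyDownFrom)
open import Data.List.Membership.Propositional using (_∈_)
open import Data.List.Membership.Propositional.Properties using (∈-applyUpTo⁻; ∈-applyDownFrom⁻; ∈-++⁻)
import Data.List.Properties as List
open import Data.List.Relation.Binary.Disjoint.Propositional using (Disjoint)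
open import Data.List.Relation.Unary.All as All using (All; []; _∷_)
open import Data.List.Relation.Unary.Any using (here; there)
open import Data.List.Relation.Unary.Unique.Propositional using (Unique; []; _∷_)
import Data.List.Relation.Unary.Unique.Propositional.Properties as Unique
open import Data.Nat as ℕ using
  (ℕ; zero; suc; _+_; _*_; _∸_; _^_; _≤_; _<_; _≥_; z≤n; s≤s; _<?_; _≤?_; NonZero; >-nonZero)
open import Data.Nat.Divisibility using (_∣_; divides; ∣⇒≤; ∣-trans; ∣m+n∣m⇒∣n)
open import Data.Nat.DivMod using
  (_/_; _%_; m≡m%n+[m/n]*n; m%n<n; [m+n]%n≡m%n; [m+kn]%n≡m%n; m<n⇒m%n≡m; n%n≡0; m<n*o⇒m/o<n)
open import Data.Nat.GCD using (gcd; gcd-GCD; gcd[m,n]∣m; gcd[m,n]∣n; gcd[m,n]≡0⇒m≡0; module Bézout)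
import Data.Nat.ListAction as ListAction
open import Data.Nat.Properties hiding (_≟_)
open import Data.Nat.Tactic.RingSolver using (solve-∀)
open import Data.Product using (Σ; ∃; ∃₂; _×_; _,_; proj₁; proj₂)
open import Data.Sum using (_⊎_; inj₁; inj₂)
open import Function using (_∘_; id)
open import Function.Definitions using (Injective)
open import Relation.Binary using (tri<; tri≈; tri>)
open import Relation.Binary.PropositionalEquality as ≡ using
  (_≡_; _≢_; refl; cong; cong₂; subst; trans; module ≡-Reasoning)
open import Relation.Nullary using (¬_; Dec; yes; no; contradiction)
open import Relation.Nullary.Decidable using
  (⌊_⌋; ¬?; _×-dec_; _→-dec_; _⊎-dec_; map′; decidable-stable)

open Sum +-*-semiring using (sum; sum-cong-≗; ∑-distrib-+; ∑-comm; *-distribˡ-sum)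

-- The number r comes from spacing. Two neighbours of the first vertex of a path that sit fewer than
-- g - 2 positions apart on it close a cycle shorter than g. So the last of r + 1 such neighbours
-- sits beyond position r(g - 2) ≥ 2(k - 1), and its edge closes a cycle of length at least 2k. A
-- chord of that cycle needs a third neighbour, hence r ≥ 2. The chord is what makes paths of length
-- ℓ informative. Along a bare cycle of length p they only show that colours repeat with period
-- gcd(ℓ, p). Paths across the chord act as reflections, and two reflections with centres one apart
-- compose to a shift by 2. Period 2 cannot be improved, since paths of even length stay on one side
-- of a bipartite graph; it is enough because only the side in L_t carries information.

private variable
  n : ℕ

-- Sums and counts over finite index sets

ind : Bool → ℕ
ind b = if b then 1 else 0

count : (Fin n → Bool) → ℕ
count P = sum (ind ∘ P)

sum-mono : {f g : Fin n → ℕ} → (∀ i → f i ≤ g i) → sum f ≤ sum g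
sum-mono {zero}  f≤g = z≤n
sum-mono {suc n} f≤g = +-mono-≤ (f≤g zero) (sum-mono (f≤g ∘ suc))

term≤sum : (f : Fin n → ℕ) → ∀ i → f i ≤ sum f
term≤sum f zero    = m≤m+n _ _
term≤sum f (suc i) = ≤-trans (term≤sum (f ∘ suc) i) (m≤n+m _ (f zero))

sum-positive : (f : Fin n → ℕ) → 0 < sum f → ∃ λ i → 0 < f i
sum-positive {suc n} f 0<∑ with f zero in eq
... | suc _ = zero , subst (0 <_) (≡.sym eq) (s≤s z≤n)
... | zero  with sum-positive (f ∘ suc) 0<∑
...   | i , 0<fi = suc i , 0<fi

sum-const-1 : ∀ n → sum {n} (λ _ → 1) ≡ n
sum-const-1 zero    = refl
sum-const-1 (suc n) = cong suc (sum-const-1 n)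

sum-zero : (f : Fin n → ℕ) → (∀ i → f i ≡ 0) → sum f ≡ 0
sum-zero {zero}  f f≡0 = refl
sum-zero {suc n} f f≡0 = cong₂ _+_ (f≡0 zero) (sum-zero (f ∘ suc) (f≡0 ∘ suc))

sum-singleton : (v : Fin n) (f : Fin n → ℕ) → sum (λ j → ind ⌊ j ≟ v ⌋ * f j) ≡ f v
sum-singleton {suc n} zero    f =
  trans (cong₂ _+_ (*-identityˡ _) (sum-zero {n} _ (λ _ → refl))) (+-identityʳ _)
sum-singleton {suc n} (suc v) f =
  trans (sum-cong-≗ λ j → cong (λ b → ind b * f (suc j)) (≟-suc j)) (sum-singleton v (f ∘ suc))
  where
  ≟-suc : ∀ j → ⌊ suc j ≟ suc v ⌋ ≡ ⌊ j ≟ v ⌋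
  ≟-suc j with j ≟ v
  ... | yes _ = refl
  ... | no  _ = refl

sum-allFin : (f : Fin n → ℕ) → ListAction.sum (List.map f (List.allFin n)) ≡ sum f
sum-allFin f = trans (cong ListAction.sum (List.map-tabulate id f)) (sum-tabulate f)
  where
  sum-tabulate : ∀ {m} (f : Fin m → ℕ) → ListAction.sum (List.tabulate f) ≡ sum f
  sum-tabulate {zero}  f = refl
  sum-tabulate {suc m} f = cong (f zero +_) (sum-tabulate (f ∘ suc))

enumerate : (P : Fin n → Bool) →
  Σ (Fin (count P) → Fin n) λ e → Injective _≡_ _≡_ e × (∀ i → P (e i) ≡ true)
enumerate {zero}  P = (λ ()) , (λ { {()} }) , λ ()
enumerate {suc n} P with P zero in eq | enumerate (P ∘ suc)
... | false | e , e-inj , eP = suc ∘ e , e-inj ∘ Fin.suc-injective , eP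
... | true  | e , e-inj , eP = e′ , e′-inj , eP′
  where
  e′ : Fin (suc (count (P ∘ suc))) → Fin (suc n)
  e′ zero    = zero
  e′ (suc i) = suc (e i)
  e′-inj : Injective _≡_ _≡_ e′
  e′-inj {zero}  {zero}  _ = refl
  e′-inj {suc i} {suc j} p = cong suc (e-inj (Fin.suc-injective p))
  eP′ : ∀ i → P (e′ i) ≡ true
  eP′ zero    = eq
  eP′ (suc i) = eP i

count-pigeonhole : ∀ {r} (P : Fin n → Bool) (f : Fin n → ℕ) → r < count P →
  (∀ v → P v ≡ true → f v < r) →
  ∃₂ λ u v → u ≢ v × P u ≡ true × P v ≡ true × f u ≡ f v
count-pigeonhole P f r<count f< with enumerate P
... | e , e-inj , eP with pigeonhole r<count (λ i → fromℕ< (f< (e i) (eP i)))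
...   | i , j , i<j , eq =
  e i , e j , (λ p → <⇒≢ i<j (cong toℕ (e-inj p))) , eP i , eP j ,
  fromℕ<-injective _ _ _ _ eq

-- For distinct `i` and `j` exactly one of the two orders is increasing, so adding the transposed
-- sum fills the other triangle of the adjacency matrix; the diagonal vanishes by irreflexivity.
2*edgeCount : (G : Graph n) → 2 * edgeCount G ≡ sum (λ i → sum (λ j → ind (adj G i j)))
2*edgeCount {n} G = begin
  2 * edgeCount G
    ≡⟨ cong (2 *_) (trans (sum-allFin (λ i → ListAction.sum (List.map (e i) (List.allFin n))))
                          (sum-cong-≗ λ i → sum-allFin (e i))) ⟩
  2 * sum (λ i → sum (e i))
    ≡⟨ cong (sum (λ i → sum (e i)) +_) (+-identityʳ _) ⟩
  sum (λ i → sum (e i)) + sum (λ i → sum (e i))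
    ≡⟨ cong (sum (λ i → sum (e i)) +_) (∑-comm e) ⟩
  sum (λ i → sum (e i)) + sum (λ i → sum (λ j → e j i))
    ≡⟨ ∑-distrib-+ (λ i → sum (e i)) _ ⟨
  sum (λ i → sum (e i) + sum (λ j → e j i))
    ≡⟨ sum-cong-≗ (λ i → ≡.sym (∑-distrib-+ (e i) _)) ⟩
  sum (λ i → sum (λ j → e i j + e j i))
    ≡⟨ sum-cong-≗ (λ i → sum-cong-≗ (orient i)) ⟩
  sum (λ i → sum (λ j → ind (adj G i j))) ∎
  where
  open ≡-Reasoning
  e : Fin n → Fin n → ℕ
  e i j = if ⌊ toℕ i <? toℕ j ⌋ then (if adj G i j then 1 else 0) else 0
  orient : ∀ i j → e i j + e j i ≡ ind (adj G i j)
  orient i j with toℕ i <? toℕ j | toℕ j <? toℕ i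
  ... | yes i<j | yes j<i = contradiction j<i (<-asym i<j)
  ... | yes _   | no  _   = +-identityʳ _
  ... | no  _   | yes _   = cong ind (Graph.sym G j i)
  ... | no  i≮j | no  j≮i with toℕ-injective (≤-antisym (≮⇒≥ j≮i) (≮⇒≥ i≮j))
  ...   | refl = cong ind (≡.sym (irrefl G i))

-- Degrees within a vertex set and subgraphs of large minimum degree

deg : Graph n → (Fin n → Bool) → Fin n → ℕ
deg G S v = sum (λ u → ind (S u) * ind (adj G v u))

degSum : Graph n → (Fin n → Bool) → ℕ
degSum G S = sum (λ v → ind (S v) * deg G S v)

module _ (G : Graph n) (S : Fin n → Bool) (v : Fin n) (Sv : S v ≡ true) where

  remove : Fin n → Bool
  remove u = S u ∧ not ⌊ u ≟ v ⌋

  private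
    split : ∀ u → ind (S u) ≡ ind (remove u) + ind ⌊ u ≟ v ⌋
    split u with u ≟ v
    split u | yes refl rewrite Sv = refl
    split u | no  _ with S u
    ... | true  = refl
    ... | false = refl

    sum-split : (f : Fin n → ℕ) →
      sum (λ u → ind (S u) * f u) ≡ sum (λ u → ind (remove u) * f u) + f v
    sum-split f = begin
      sum (λ u → ind (S u) * f u)
        ≡⟨ sum-cong-≗ (λ u → trans (cong (_* f u) (split u)) (*-distribʳ-+ (f u) (ind (remove u)) _)) ⟩
      sum (λ u → ind (remove u) * f u + ind ⌊ u ≟ v ⌋ * f u)
        ≡⟨ ∑-distrib-+ (λ u → ind (remove u) * f u) _ ⟩
      sum (λ u → ind (remove u) * f u) + sum (λ u → ind ⌊ u ≟ v ⌋ * f u)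
        ≡⟨ cong (sum (λ u → ind (remove u) * f u) +_) (sum-singleton v f) ⟩
      sum (λ u → ind (remove u) * f u) + f v ∎
      where open ≡-Reasoning

  count-remove : count S ≡ suc (count remove)
  count-remove = begin
    count S                           ≡⟨ sum-cong-≗ (λ u → ≡.sym (*-identityʳ (ind (S u)))) ⟩
    sum (λ u → ind (S u) * 1)         ≡⟨ sum-split (λ _ → 1) ⟩
    sum (λ u → ind (remove u) * 1) + 1 ≡⟨ +-comm _ 1 ⟩
    suc (sum (λ u → ind (remove u) * 1)) ≡⟨ cong suc (sum-cong-≗ (λ u → *-identityʳ (ind (remove u)))) ⟩
    suc (count remove) ∎
    where open ≡-Reasoning

  -- The degree of `v` is lost twice: once as the term of `v` itself, and once spread over its
  -- neighbours, each of which loses one. By irreflexivity the sum over `remove` already sees all of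
  -- these neighbours.
  degSum-remove : degSum G S ≡ degSum G remove + 2 * deg G S v
  degSum-remove = begin
    degSum G S
      ≡⟨ sum-split (deg G S) ⟩
    sum (λ u → ind (remove u) * deg G S u) + deg G S v
      ≡⟨ cong (_+ deg G S v) (sum-cong-≗ λ u →
           trans (cong (ind (remove u) *_) (sum-split (ind ∘ adj G u)))
                 (*-distribˡ-+ (ind (remove u)) (deg G remove u) _)) ⟩
    sum (λ u → ind (remove u) * deg G remove u + ind (remove u) * ind (adj G u v)) + deg G S v
      ≡⟨ cong (_+ deg G S v) (∑-distrib-+ (λ u → ind (remove u) * deg G remove u) _) ⟩
    degSum G remove + sum (λ u → ind (remove u) * ind (adj G u v)) + deg G S v
      ≡⟨ cong (λ x → degSum G remove + x + deg G S v) to-v ⟩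
    degSum G remove + deg G S v + deg G S v
      ≡⟨ regroup (degSum G remove) (deg G S v) ⟩
    degSum G remove + 2 * deg G S v ∎
    where
    open ≡-Reasoning
    regroup : ∀ a b → a + b + b ≡ a + 2 * b
    regroup = solve-∀
    to-v : sum (λ u → ind (remove u) * ind (adj G u v)) ≡ deg G S v
    to-v = begin
      sum (λ u → ind (remove u) * ind (adj G u v))
        ≡⟨ sum-cong-≗ (λ u → cong (λ b → ind (remove u) * ind b) (Graph.sym G u v)) ⟩
      sum (λ u → ind (remove u) * ind (adj G v u))
        ≡⟨ +-identityʳ _ ⟨
      sum (λ u → ind (remove u) * ind (adj G v u)) + 0
        ≡⟨ cong (λ b → sum (λ u → ind (remove u) * ind (adj G v u)) + ind b) (irrefl G v) ⟨
      sum (λ u → ind (remove u) * ind (adj G v u)) + ind (adj G v v)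
        ≡⟨ sum-split (ind ∘ adj G v) ⟨
      deg G S v ∎

-- Deleting a vertex with q * deg ≤ p keeps the density hypothesis.
dense⇒minDegree : (G : Graph n) (p q : ℕ) (S : Fin n → Bool) →
  p * 2 * count S < q * degSum G S →
  Σ (Fin n → Bool) λ T → (∃ λ v → T v ≡ true) ×
    (∀ v → T v ≡ true → p < q * deg G T v)
dense⇒minDegree {n} G p q S = go (count S) S ≤-refl
  where
  go : ∀ m (S : Fin n → Bool) → count S ≤ m → p * 2 * count S < q * degSum G S →
    Σ (Fin n → Bool) λ T → (∃ λ v → T v ≡ true) ×
      (∀ v → T v ≡ true → p < q * deg G T v)
  go m S S≤m dense with any? (λ v → (S v Bool.≟ true) ×-dec (q * deg G S v ≤? p))
  ... | no none = S , nonempty , λ v Sv → ≰⇒> λ le → none (v , Sv , le)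
    where
    nonempty : ∃ λ v → S v ≡ true
    nonempty with sum-positive _ (positive q (degSum G S) (≤-<-trans z≤n dense))
      where
      positive : ∀ q x → 0 < q * x → 0 < x
      positive q zero    lt = contradiction lt (subst (λ y → ¬ 0 < y) (≡.sym (*-zeroʳ q)) λ ())
      positive q (suc x) lt = s≤s z≤n
    ... | v , lt with S v in Sv
    ...   | true  = v , Sv
    ...   | false = contradiction lt λ ()
  go zero    S S≤m dense | yes (v , Sv , _) = contradiction (subst (_≤ 0) (count-remove G S v Sv) S≤m) λ ()
  go (suc m) S S≤m dense | yes (v , Sv , low)
    = go m (remove G S v Sv) (≤-pred (subst (_≤ suc m) (count-remove G S v Sv) S≤m)) dense′
    where
    dense′ : p * 2 * count (remove G S v Sv) < q * degSum G (remove G S v Sv)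
    dense′ = +-cancelʳ-< (p * 2) _ _ (begin-strict
      p * 2 * count (remove G S v Sv) + p * 2      ≡⟨ +-comm _ (p * 2) ⟩
      p * 2 + p * 2 * count (remove G S v Sv)      ≡⟨ *-suc (p * 2) _ ⟨
      p * 2 * suc (count (remove G S v Sv))        ≡⟨ cong (p * 2 *_) (count-remove G S v Sv) ⟨
      p * 2 * count S                              <⟨ dense ⟩
      q * degSum G S                               ≡⟨ cong (q *_) (degSum-remove G S v Sv) ⟩
      q * (degSum G (remove G S v Sv) + 2 * deg G S v) ≡⟨ regroup q _ _ ⟩
      q * degSum G (remove G S v Sv) + q * deg G S v * 2 ≤⟨ +-monoʳ-≤ (q * degSum G (remove G S v Sv)) (*-monoˡ-≤ 2 low) ⟩
      q * degSum G (remove G S v Sv) + p * 2       ∎)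
      where
      open ≤-Reasoning
      regroup : ∀ q x y → q * (x + 2 * y) ≡ q * x + q * y * 2
      regroup = solve-∀

-- Periods of sequences

Period : {A : Set} → (ℕ → A) → ℕ → Set
Period f t = ∀ i → f (i + t) ≡ f i

module _ {A : Set} {f : ℕ → A} where

  period-* : ∀ {t} m → Period f t → Period f (m * t)
  period-* zero    per i = cong f (+-identityʳ i)
  period-* {t} (suc m) per i =
    trans (cong f (≡.sym (+-assoc i t (m * t)))) (trans (period-* m per (i + t)) (per i))

  -- Congruence modulo `e` is witnessed by multiples added on both sides, which avoids truncated
  -- subtraction.
  period-cong : ∀ {e} → Period f e → ∀ {x y} u v → x + u * e ≡ y + v * e → f x ≡ f y
  period-cong per {x} {y} u v eq =
    trans (≡.sym (period-* u per x)) (trans (cong f eq) (period-* v per y))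

  -- The subtraction step of the Euclidean algorithm. It only looks forward, from `i + s` to
  -- `i + s + t`, so one-sided sequences suffice.
  period-cancel : ∀ {s t} → Period f t → Period f (s + t) → Period f s
  period-cancel {s} {t} per-t per-s+t i =
    trans (≡.sym (per-t (i + s))) (trans (cong f (+-assoc i s t)) (per-s+t i))

  period-gcd : ∀ {m n} → Period f m → Period f n → Period f (gcd m n)
  period-gcd {m} {n} per-m per-n with Bézout.identity (gcd-GCD m n)
  ... | Bézout.+- x y eq = period-cancel (period-* y per-n) (subst (Period f) (≡.sym eq) (period-* x per-m))
  ... | Bézout.-+ x y eq = period-cancel (period-* x per-m) (subst (Period f) (≡.sym eq) (period-* y per-n))

  period-shift : ∀ {t} k → Period f t → Period (f ∘ (k +_)) t
  period-shift {t} k per i = trans (cong f (≡.sym (+-assoc k i t))) (per (k + i))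

module _ {A : Set} {F G : ℕ → A} {e : ℕ} (perF : Period F (suc e)) (perG : Period G (suc e)) where

  agree : (∀ a → a < suc e → F a ≡ G a) → ∀ a → F a ≡ G a
  agree eq a = begin
    F a            ≡⟨ period-cong perF 0 (a / suc e) a≡ ⟩
    F (a % suc e)  ≡⟨ eq _ (m%n<n a (suc e)) ⟩
    G (a % suc e)  ≡⟨ period-cong perG 0 (a / suc e) a≡ ⟨
    G a            ∎
    where
    open ≡-Reasoning
    a≡ : a + 0 ≡ a % suc e + (a / suc e) * suc e
    a≡ = trans (+-identityʳ a) (m≡m%n+[m/n]*n a (suc e))

  -- Only residues matter: the period moves `a` into the window at `a₀`, the partner `b*` is read
  -- off from `ℓ`, and `b*` is congruent to `b` because `suc e` divides both `ℓ` and `suc (a + b)`.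
  reflect-agree : ∀ {ℓ} a₀ → suc e ∣ ℓ → a₀ + suc e ≤ ℓ →
    (∀ a b → a₀ ≤ a → a < a₀ + suc e → suc (a + b) ≡ ℓ → F a ≡ G b) →
    ∀ a b → suc e ∣ suc (a + b) → F a ≡ G b
  reflect-agree {ℓ} a₀ (divides q ℓ≡) bound eq a b (divides w ab≡) = begin
    F a  ≡⟨ period-cong perF a₀ v a~ ⟩
    F a* ≡⟨ eq a* b* (m≤m+n a₀ _) a*< ab*≡ ⟩
    G b* ≡⟨ period-cong perG (q + v) (w + a₀) b~ ⟨
    G b  ∎
    where
    open ≡-Reasoning
    -- Modulo `suc e` the number `e` is -1, so `x` represents `a` minus `a₀`.
    x = a + a₀ * e
    v = x / suc e
    a* = a₀ + x % suc e
    a*< : a* < a₀ + suc e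
    a*< = +-monoʳ-< a₀ (m%n<n x (suc e))
    a~ : a + a₀ * suc e ≡ a* + v * suc e
    a~ = begin
      a + a₀ * suc e              ≡⟨ lemma a a₀ e ⟩
      a₀ + x                      ≡⟨ cong (a₀ +_) (m≡m%n+[m/n]*n x (suc e)) ⟩
      a₀ + (x % suc e + v * suc e) ≡⟨ +-assoc a₀ _ _ ⟨
      a* + v * suc e              ∎
      where
      lemma : ∀ a a₀ e → a + a₀ * suc e ≡ a₀ + (a + a₀ * e)
      lemma = solve-∀
    a*<ℓ : a* < ℓ
    a*<ℓ = <-≤-trans a*< bound
    b* = proj₁ (m≤n⇒∃[o]m+o≡n a*<ℓ)
    ab*≡ : suc (a* + b*) ≡ ℓ
    ab*≡ = proj₂ (m≤n⇒∃[o]m+o≡n a*<ℓ)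
    b~ : b + (q + v) * suc e ≡ b* + (w + a₀) * suc e
    b~ = begin
      b + (q + v) * suc e                 ≡⟨ cong (b +_) (*-distribʳ-+ (suc e) q v) ⟩
      b + (q * suc e + v * suc e)         ≡⟨ cong (λ z → b + (z + v * suc e)) (trans (≡.sym ℓ≡) (≡.sym ab*≡)) ⟩
      b + (suc (a* + b*) + v * suc e)     ≡⟨ lemma₁ b a* b* (v * suc e) ⟩
      suc (b + b* + (a* + v * suc e))     ≡⟨ cong (λ z → suc (b + b* + z)) a~ ⟨
      suc (b + b* + (a + a₀ * suc e))     ≡⟨ lemma₂ b b* a (a₀ * suc e) ⟩
      b* + (suc (a + b) + a₀ * suc e)     ≡⟨ cong (λ z → b* + (z + a₀ * suc e)) ab≡ ⟩
      b* + (w * suc e + a₀ * suc e)       ≡⟨ cong (b* +_) (*-distribʳ-+ (suc e) w a₀) ⟨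
      b* + (w + a₀) * suc e               ∎
      where
      lemma₁ : ∀ b a* b* z → b + (suc (a* + b*) + z) ≡ suc (b + b* + (a* + z))
      lemma₁ = solve-∀
      lemma₂ : ∀ b b* a z → suc (b + b* + (a + z)) ≡ b* + (suc (a + b) + z)
      lemma₂ = solve-∀

-- Here f is a colouring along a cycle of length p with chord from 0 to s, and the hypotheses equate the colours at the
-- ends of the paths of length ℓ through the chord: cross₁ and cross₂ for those with one arc on each side of the chord,
-- parallel₁ and parallel₂ for those with both arcs on one side. Ends are shifted by the periods p and ℓ so that no
-- subtraction occurs.
module _ {A : Set} {f : ℕ → A} {p ℓ s : ℕ}
  (cross₁ : ∀ a b → a < s → s + b < p → suc (a + b) ≡ ℓ → f a ≡ f (s + b))
  (cross₂ : ∀ a b → a < s → s + b < p → suc (a + b) ≡ ℓ → f (suc a) ≡ f (suc (s + b)))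
  where

  -- Modulo the period e + 1 of f, a divisor of ℓ, cross₁ reads f a = f (s - 1 - a) and cross₂ reads f a = f (s + 1 - a).
  crossing⇒period-2 : ∀ e → Period f (suc e) → suc e ∣ ℓ → suc e ≤ ℓ →
    suc e ≤ s → s + suc e ≤ p → ℓ + suc e ≤ p → Period f 2
  crossing⇒period-2 e per e∣ℓ e≤ℓ e≤s s+e≤p ℓ+e≤p y = begin
    f (y + 2)                  ≡⟨ period-cong per s 0 (lemma₁ y s e) ⟩
    f (suc (s + suc b))        ≡⟨ refl₂ (e + e + b * e) (suc b) (divides (2 + b) (lemma₂ b e)) ⟨
    f (suc (e + e + b * e))    ≡⟨ refl₁ (suc (e + e + b * e)) b (divides (2 + b) (lemma₃ b e)) ⟩
    f (s + b)                  ≡⟨ period-cong per 0 s (lemma₄ y s e) ⟩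
    f y                        ∎
    where
    open ≡-Reasoning
    -- Again `e` plays -1: `b` represents `y - s`, and `suc (e + e + b * e)` in the chain represents
    -- `- 1 - b`.
    b = y + s * e
    lemma₁ : ∀ y s e → y + 2 + s * suc e ≡ suc (s + suc (y + s * e)) + 0
    lemma₁ = solve-∀
    lemma₂ : ∀ b e → suc (e + e + b * e + suc b) ≡ (2 + b) * suc e
    lemma₂ = solve-∀
    lemma₃ : ∀ b e → suc (suc (e + e + b * e) + b) ≡ (2 + b) * suc e
    lemma₃ = solve-∀
    lemma₄ : ∀ y s e → s + (y + s * e) + 0 ≡ y + s * suc e
    lemma₄ = solve-∀

    -- The values of `a` that satisfy both side conditions start at 0 or at `s + ℓ - p`, whichever
    -- is larger. The bounds on `suc e` say exactly that a full set of residues fits between this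
    -- start and both `s` and `ℓ`.
    window : Σ ℕ λ a₀ → a₀ + suc e ≤ ℓ ×
      (∀ a b → a₀ ≤ a → a < a₀ + suc e → suc (a + b) ≡ ℓ → a < s × s + b < p)
    window with s + ℓ ≤? p
    ... | yes s+ℓ≤p = 0 , e≤ℓ , λ a b _ a<e ab≡ →
      <-≤-trans a<e e≤s ,
      <-≤-trans (+-monoʳ-< s (subst (b <_) ab≡ (s≤s (m≤n+m b a)))) s+ℓ≤p
    ... | no  s+ℓ≰p with m≤n⇒∃[o]m+o≡n (≰⇒≥ s+ℓ≰p)
    ...   | a₀ , p+a₀≡ = a₀ , +-cancelˡ-≤ p _ _ bound₁ , λ a b a₀≤a a< ab≡ →
      <-≤-trans a< (+-cancelˡ-≤ p _ _ bound₂) , +-cancelʳ-≤ a _ _ (bound₃ a b a₀≤a ab≡)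
      where
      regroup : ∀ s ℓ e → s + ℓ + e ≡ ℓ + (s + e)
      regroup = solve-∀
      bound₁ : p + (a₀ + suc e) ≤ p + ℓ
      bound₁ = ≤-trans (≤-reflexive (trans (≡.sym (+-assoc p a₀ _)) (trans (cong (_+ suc e) p+a₀≡) (regroup s ℓ (suc e)))))
                 (≤-trans (+-monoʳ-≤ ℓ s+e≤p) (≤-reflexive (+-comm ℓ p)))
      bound₂ : p + (a₀ + suc e) ≤ p + s
      bound₂ = ≤-trans (≤-reflexive (trans (≡.sym (+-assoc p a₀ _)) (trans (cong (_+ suc e) p+a₀≡) (+-assoc s ℓ _))))
                 (≤-trans (+-monoʳ-≤ s ℓ+e≤p) (≤-reflexive (+-comm s p)))
      bound₃ : ∀ a b → a₀ ≤ a → suc (a + b) ≡ ℓ → suc (s + b) + a ≤ p + a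
      bound₃ a b a₀≤a ab≡ = ≤-trans (≤-reflexive (trans (swap s b a) (trans (cong (s +_) ab≡) (≡.sym p+a₀≡)))) (+-monoʳ-≤ p a₀≤a)
        where
        swap : ∀ s b a → suc (s + b) + a ≡ s + suc (a + b)
        swap = solve-∀

    refl₁ : ∀ a b → suc e ∣ suc (a + b) → f a ≡ f (s + b)
    refl₁ with window
    ... | a₀ , a₀+e≤ℓ , ok = reflect-agree per (period-shift s per) a₀ e∣ℓ a₀+e≤ℓ
      λ a b a₀≤a a< ab≡ → cross₁ a b (proj₁ (ok a b a₀≤a a< ab≡)) (proj₂ (ok a b a₀≤a a< ab≡)) ab≡
    refl₂ : ∀ a b → suc e ∣ suc (a + b) → f (suc a) ≡ f (suc (s + b))
    refl₂ with window
    ... | a₀ , a₀+e≤ℓ , ok = reflect-agree (period-shift 1 per) (period-shift (suc s) per) a₀ e∣ℓ a₀+e≤ℓ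
      λ a b a₀≤a a< ab≡ → cross₂ a b (proj₁ (ok a b a₀≤a a< ab≡)) (proj₂ (ok a b a₀≤a a< ab≡)) ab≡

  -- The gcd `suc d` of `ℓ` and `p` is a period dividing `ℓ`, and `ℓ + suc d ≤ p` since it also
  -- divides the positive difference `p - ℓ`. The crossing argument further needs room for `suc d`
  -- positions on each side of the chord; only this can fail.
  chord-periods⇒period-2 : 1 ≤ ℓ → ℓ < p → 1 < s → suc s < p → Period f p → Period f ℓ →
    (s + ℓ ≤ p → ∀ b → b < ℓ → f (suc b) ≡ f (s + b)) →
    (ℓ ≤ s → ∀ a → a < ℓ → f a ≡ f (suc (s + a))) →
    Period f 2
  chord-periods⇒period-2 1≤ℓ ℓ<p 1<s 1+s<p per-p per-ℓ parallel₁ parallel₂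
    = go (gcd ℓ p) refl
    where
    ∣+⇒≤ : ∀ {d w} → d ∣ w → 1 ≤ w → d ≤ w
    ∣+⇒≤ {w = suc w} d∣w _ = ∣⇒≤ d∣w
    positive : ∀ {a b} → a < b → ∃ λ w → a + suc w ≡ b
    positive {a} a<b with m≤n⇒∃[o]m+o≡n a<b
    ... | w , eq = w , trans (+-suc a w) eq
    gap = positive ℓ<p
    go : ∀ d → gcd ℓ p ≡ d → Period f 2
    go zero    eq = contradiction (gcd[m,n]≡0⇒m≡0 {ℓ} {p} eq) λ { refl → contradiction 1≤ℓ λ () }
    go (suc d) eq = cases
      where
      d∣ℓ : suc d ∣ ℓ
      d∣ℓ = subst (_∣ ℓ) eq (gcd[m,n]∣m ℓ p)
      d∣p : suc d ∣ p
      d∣p = subst (_∣ p) eq (gcd[m,n]∣n ℓ p)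
      d≤ℓ : suc d ≤ ℓ
      d≤ℓ = ∣+⇒≤ d∣ℓ 1≤ℓ
      ℓ+d≤p : ℓ + suc d ≤ p
      ℓ+d≤p = subst (ℓ + suc d ≤_) (proj₂ gap) (+-monoʳ-≤ ℓ
        (∣+⇒≤ (∣m+n∣m⇒∣n (subst (suc d ∣_) (≡.sym (proj₂ gap)) d∣p) d∣ℓ) (s≤s z≤n)))
      per-d : Period f (suc d)
      per-d = subst (Period f) eq (period-gcd per-ℓ per-p)

      -- When one side of the chord is shorter than d, a parallel hypothesis gives a smaller period t, and gcd d t
      -- fits on both sides.
      refine : ∀ t → 1 ≤ t → Period f t → t ≤ s → s + t ≤ p → Period f 2
      refine t 1≤t per-t t≤s s+t≤p with gcd (suc d) t in eq′
      ... | zero  = contradiction (gcd[m,n]≡0⇒m≡0 {suc d} {t} eq′) λ ()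
      ... | suc e = crossing⇒period-2 e (subst (Period f) eq′ (period-gcd per-d per-t))
          (∣-trans e∣d d∣ℓ) (≤-trans e≤d d≤ℓ) (≤-trans e≤t t≤s)
          (≤-trans (+-monoʳ-≤ s e≤t) s+t≤p) (≤-trans (+-monoʳ-≤ ℓ e≤d) ℓ+d≤p)
        where
        e∣d : suc e ∣ suc d
        e∣d = subst (_∣ suc d) eq′ (gcd[m,n]∣m (suc d) t)
        e≤d : suc e ≤ suc d
        e≤d = ∣⇒≤ e∣d
        e≤t : suc e ≤ t
        e≤t = ∣+⇒≤ (subst (_∣ t) eq′ (gcd[m,n]∣n (suc d) t)) 1≤t

      cases : Period f 2
      cases with suc d ≤? s | s + suc d ≤? p
      ... | yes d≤s | yes s+d≤p = crossing⇒period-2 d per-d d∣ℓ d≤ℓ d≤s s+d≤p ℓ+d≤p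
      -- Here `t` is `s - 1`: the parallel paths identify the colours at `suc a` and `s + a`.
      ... | no d≰s  | _ = refine t (s≤s z≤n) per-t
          (≤-trans (n≤1+n t) (≤-reflexive 1+t≡s))
          (≤-trans (+-mono-≤ s≤ℓ (≤-trans (n≤1+n t) (≤-trans (≤-reflexive 1+t≡s) s≤d))) ℓ+d≤p)
        where
        t = suc (proj₁ (positive 1<s))
        1+t≡s : suc t ≡ s
        1+t≡s = proj₂ (positive 1<s)
        s≤d : s ≤ suc d
        s≤d = ≰⇒≥ d≰s
        s≤ℓ : s ≤ ℓ
        s≤ℓ = ≤-trans s≤d d≤ℓ
        parallel : ∀ a → f (suc a) ≡ f (s + a)
        parallel = agree (period-shift 1 per-d) (period-shift s per-d)
          λ a a<d → parallel₁ (≤-trans (+-monoˡ-≤ ℓ s≤d) (≤-trans (≤-reflexive (+-comm (suc d) ℓ)) ℓ+d≤p))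
                              a (<-≤-trans a<d d≤ℓ)
        per-t : Period f t
        -- Going up by `suc d` first produces an index of the form `suc a`, as `parallel` requires.
        per-t i = begin
          f (i + t)             ≡⟨ per-d (i + t) ⟨
          f (i + t + suc d)     ≡⟨ cong f (regroup i t d) ⟩
          f (suc t + (i + d))   ≡⟨ cong (λ z → f (z + (i + d))) 1+t≡s ⟩
          f (s + (i + d))       ≡⟨ parallel (i + d) ⟨
          f (suc (i + d))       ≡⟨ cong f (+-suc i d) ⟨
          f (i + suc d)         ≡⟨ per-d i ⟩
          f i                   ∎
          where
          open ≡-Reasoning
          regroup : ∀ i t d → i + t + suc d ≡ suc t + (i + d)
          regroup = solve-∀
      -- Here `t` is `p - s - 1`: the parallel paths make `suc s` a period, and cancelling it from
      -- the period `p` leaves `t`.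
      ... | yes d≤s | no s+d≰p = refine t (s≤s z≤n) per-t
          (≤-trans (<⇒≤ t<d) d≤s)
          (≤-trans (n≤1+n (s + t)) (≤-reflexive 1+s+t≡p))
        where
        t = suc (proj₁ (positive 1+s<p))
        1+s+t≡p : suc s + t ≡ p
        1+s+t≡p = proj₂ (positive 1+s<p)
        t<d : t < suc d
        t<d = +-cancelˡ-< s _ _ (<-trans (≤-reflexive 1+s+t≡p) (≰⇒> s+d≰p))
        ℓ≤s : ℓ ≤ s
        ℓ≤s = +-cancelʳ-≤ (suc d) _ _ (≤-trans ℓ+d≤p (≰⇒≥ s+d≰p))
        per-1+s : Period f (suc s)
        per-1+s i = ≡.sym (trans (agree per-d (period-shift (suc s) per-d)
                                        (λ a a<d → parallel₂ ℓ≤s a (<-≤-trans a<d d≤ℓ)) i)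
                                 (cong f (+-comm (suc s) i)))
        per-t : Period f t
        per-t = period-cancel per-1+s (subst (Period f) (trans (≡.sym 1+s+t≡p) (+-comm (suc s) t)) per-p)

-- Walks and cycles with a chord

data Walk {V : Set} (R : V → V → Set) : V → V → ℕ → Set where
  [_] : ∀ x → Walk R x x 0
  _∷_ : ∀ {x y z m} → R x y → Walk R y z m → Walk R x z (suc m)

module _ {V : Set} {R : V → V → Set} where

  vertices : ∀ {x y m} → Walk R x y m → List V
  vertices [ x ]           = x ∷ []
  vertices (_∷_ {x} _ w)   = x ∷ vertices w

  infixr 5 _▷_▷_
  -- Walks are linked by an edge rather than glued at a shared vertex. The vertex lists then simply
  -- concatenate, and uniqueness reduces to disjointness.
  _▷_▷_ : ∀ {x y z w m l} → Walk R x y m → R y z → Walk R z w l → Walk R x w (suc (m + l))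
  [ _ ]   ▷ r ▷ w′ = r ∷ w′
  (q ∷ w) ▷ r ▷ w′ = q ∷ (w ▷ r ▷ w′)

  vertices-▷ : ∀ {x y z w m l} (p : Walk R x y m) (r : R y z) (q : Walk R z w l) →
    vertices (p ▷ r ▷ q) ≡ vertices p ++ vertices q
  vertices-▷ [ _ ]   r q = refl
  vertices-▷ (_ ∷ p) r q = cong (_ ∷_) (vertices-▷ p r q)

  ascend : (f : ℕ → V) → ∀ m → (∀ i → i < m → R (f i) (f (suc i))) → Walk R (f 0) (f m) m
  ascend f zero    r = [ f 0 ]
  ascend f (suc m) r = r 0 (s≤s z≤n) ∷ ascend (f ∘ suc) m (λ i i<m → r (suc i) (s≤s i<m))

  vertices-ascend : ∀ f m r → vertices (ascend f m r) ≡ applyUpTo f (suc m)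
  vertices-ascend f zero    r = refl
  vertices-ascend f (suc m) r = cong (f 0 ∷_) (vertices-ascend (f ∘ suc) m _)

  descend : (f : ℕ → V) → ∀ m → (∀ i → i < m → R (f (suc i)) (f i)) → Walk R (f m) (f 0) m
  descend f zero    r = [ f 0 ]
  descend f (suc m) r = r m ≤-refl ∷ descend f m (λ i i<m → r i (m≤n⇒m≤1+n i<m))

  vertices-descend : ∀ f m r → vertices (descend f m r) ≡ applyDownFrom f (suc m)
  vertices-descend f zero    r = refl
  vertices-descend f (suc m) r = cong (f (suc m) ∷_) (vertices-descend f m _)

  at : ∀ {x y m} → Walk R x y m → Fin (suc m) → V
  at {x} w       zero    = x
  at     (_ ∷ w) (suc i) = at w i

  at-∈ : ∀ {x y m} (w : Walk R x y m) i → at w i ∈ vertices w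
  at-∈ [ _ ]   zero    = here refl
  at-∈ (_ ∷ w) zero    = here refl
  at-∈ (_ ∷ w) (suc i) = there (at-∈ w i)

  at-injective : ∀ {x y m} (w : Walk R x y m) → Unique (vertices w) → Injective _≡_ _≡_ (at w)
  at-injective w       _        {zero}  {zero}  _  = refl
  at-injective (_ ∷ w) (x∉ ∷ _) {zero}  {suc j} eq = contradiction eq (All.lookup x∉ (at-∈ w j))
  at-injective (_ ∷ w) (x∉ ∷ _) {suc i} {zero}  eq = contradiction (≡.sym eq) (All.lookup x∉ (at-∈ w i))
  at-injective (_ ∷ w) (_ ∷ u)  {suc i} {suc j} eq = cong suc (at-injective w u eq)

  at-step : ∀ {x y m} (w : Walk R x y m) i j → toℕ j ≡ suc (toℕ i) → R (at w i) (at w j)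
  at-step (r ∷ w) zero    (suc zero) _  = r
  at-step (_ ∷ w) (suc i) (suc j)    eq = at-step w i j (suc-injective eq)

  at-last : ∀ {x y m} (w : Walk R x y m) i → toℕ i ≡ m → at w i ≡ y
  at-last [ _ ]   zero    _  = refl
  at-last (_ ∷ w) (suc i) eq = at-last w i (suc-injective eq)

  mapWalk : ∀ {R′ : V → V → Set} → (∀ {x y} → R x y → R′ x y) → ∀ {x y m} → Walk R x y m → Walk R′ x y m
  mapWalk f [ x ]   = [ x ]
  mapWalk f (r ∷ w) = f r ∷ mapWalk f w

vertices-map : ∀ {V : Set} {R R′ : V → V → Set} (f : ∀ {x y} → R x y → R′ x y) {x y m} (w : Walk R x y m) →
  vertices (mapWalk {R′ = R′} f w) ≡ vertices w
vertices-map f [ x ]   = refl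
vertices-map f (_ ∷ w) = cong (_ ∷_) (vertices-map f w)

closedWalk⇒HasCycle : ∀ {n} (G : Graph n) {x y m} (w : Walk (Adj G) x y m) → Unique (vertices w) →
  Adj G y x → 2 ≤ m → HasCycle G (suc m)
closedWalk⇒HasCycle G w u yx 2≤m = s≤s 2≤m , at w , at-injective w u , λ where
  i j (inj₁ eq)        → at-step w i j eq
  i zero (inj₂ (eq , _)) → subst (λ v → Adj G v _) (≡.sym (at-last w i eq)) yx

Joined : {V : Set} (R : V → V → Set) → ℕ → V → V → Set
Joined R ℓ x y = Σ (Walk R x y ℓ) (Unique ∘ vertices)

-- A periodic sequence on ℕ instead of a map from `Fin p` lets arcs run past the index 0 without
-- wrapping. The last two fields say that the chord is not an edge of the cycle.
record ChordedCycle {V : Set} (R : V → V → Set) (p s : ℕ) : Set where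
  field
    c        : ℕ → V
    periodic : Period c p
    edge     : ∀ i → R (c i) (c (suc i))
    distinct : ∀ {i j} → i < j → j < i + p → c i ≢ c j
    chord    : R (c 0) (c s)
    1<s      : 1 < s
    1+s<p    : suc s < p

module _ {V : Set} {R : V → V → Set} (R-sym : ∀ {x y} → R x y → R y x)
         {p s : ℕ} (C : ChordedCycle R p s) where

  open ChordedCycle C

  private
    record Arc (lo m : ℕ) (x y : V) : Set where
      field
        walk   : Walk R x y m
        unique : Unique (vertices walk)
        range  : ∀ {v} → v ∈ vertices walk → ∃ λ i → lo ≤ i × i ≤ lo + m × v ≡ c i

    distinct-from : ∀ lo {m i j} → m < p → i < j → j < suc m → c (lo + i) ≢ c (lo + j)
    distinct-from lo {m} {i} {j} m<p i<j j≤m = distinct (+-monoʳ-< lo i<j)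
      (≤-trans (+-monoʳ-< lo (≤-trans j≤m m<p)) (+-monoˡ-≤ p (m≤m+n lo i)))

    up : ∀ lo m → m < p → Arc lo m (c (lo + 0)) (c (lo + m))
    up lo m m<p = record
      { walk   = walk
      ; unique = subst Unique (≡.sym vs) (Unique.applyUpTo⁺₁ f (suc m) (distinct-from lo m<p))
      ; range  = λ v∈ → let i , i≤m , eq = ∈-applyUpTo⁻ f (subst (_ ∈_) vs v∈) in
                   lo + i , m≤m+n lo i , +-monoʳ-≤ lo (≤-pred i≤m) , eq
      }
      where
      f = c ∘ (lo +_)
      step : ∀ i → i < m → R (f i) (f (suc i))
      step i _ = subst (λ z → R (f i) (c z)) (≡.sym (+-suc lo i)) (edge (lo + i))
      walk = ascend f m step
      vs = vertices-ascend f m step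

    down : ∀ lo m → m < p → Arc lo m (c (lo + m)) (c (lo + 0))
    down lo m m<p = record
      { walk   = walk
      ; unique = subst Unique (≡.sym vs) (Unique.applyDownFrom⁺₁ f (suc m)
                   (λ j<i i≤m → distinct-from lo m<p j<i i≤m ∘ ≡.sym))
      ; range  = λ v∈ → let i , i≤m , eq = ∈-applyDownFrom⁻ f (subst (_ ∈_) vs v∈) in
                   lo + i , m≤m+n lo i , +-monoʳ-≤ lo (≤-pred i≤m) , eq
      }
      where
      f = c ∘ (lo +_)
      step : ∀ i → i < m → R (f (suc i)) (f i)
      step i _ = R-sym (subst (λ z → R (f i) (c z)) (≡.sym (+-suc lo i)) (edge (lo + i)))
      walk = descend f m step
      vs = vertices-descend f m step

    -- Disjointness is arithmetic on index ranges: one range has to lie after the other and before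
    -- the copy of that other shifted by `p`.
    join : ∀ {lo lo′ m m′ x y z w} → Arc lo m x y → R y z → Arc lo′ m′ z w →
      (lo + m < lo′ × lo′ + m′ < lo + p) ⊎ (lo′ + m′ < lo × lo + m < lo′ + p) →
      Joined R (suc (m + m′)) x w
    join {lo} {lo′} {m} {m′} A r B apart =
      (A.walk ▷ r ▷ B.walk) ,
      subst Unique (≡.sym (vertices-▷ A.walk r B.walk)) (Unique.++⁺ A.unique B.unique disjoint)
      where
      module A = Arc A
      module B = Arc B
      apart⇒≢ : (lo + m < lo′ × lo′ + m′ < lo + p) ⊎ (lo′ + m′ < lo × lo + m < lo′ + p) →
        ∀ {i j} → lo ≤ i → i ≤ lo + m → lo′ ≤ j → j ≤ lo′ + m′ → c i ≢ c j
      apart⇒≢ (inj₁ (below , around)) lo≤i i≤ lo′≤j j≤ =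
        distinct (≤-<-trans i≤ (<-≤-trans below lo′≤j)) (≤-<-trans j≤ (<-≤-trans around (+-monoˡ-≤ p lo≤i)))
      apart⇒≢ (inj₂ (below , around)) lo≤i i≤ lo′≤j j≤ =
        distinct (≤-<-trans j≤ (<-≤-trans below lo≤i)) (≤-<-trans i≤ (<-≤-trans around (+-monoˡ-≤ p lo′≤j))) ∘ ≡.sym
      disjoint : Disjoint (vertices A.walk) (vertices B.walk)
      disjoint (v∈A , v∈B) with A.range v∈A | B.range v∈B
      ... | i , lo≤i , i≤ , refl | j , lo′≤j , j≤ , eq = apart⇒≢ apart lo≤i i≤ lo′≤j j≤ eq

    c-0+ : ∀ i → c (i + 0) ≡ c i
    c-0+ i = cong c (+-identityʳ i)

  module _ {A : Set} (χ : V → A) {ℓ : ℕ} (1≤ℓ : 1 ≤ ℓ) (ℓ<p : ℓ < p)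
           (constant : ∀ i j → Joined R ℓ (c i) (c j) → χ (c i) ≡ χ (c j)) where

    private
      f = χ ∘ c
      per-p : Period f p
      per-p i = cong χ (periodic i)
      per-ℓ : Period f ℓ
      per-ℓ i = trans (≡.sym (constant _ _ (Arc.walk (up i ℓ ℓ<p) , Arc.unique (up i ℓ ℓ<p)))) (cong χ (c-0+ i))

      via-chord : ∀ m m′ {i j} → suc (m + m′) ≡ ℓ → Joined R (suc (m + m′)) (c i) (c j) → f i ≡ f j
      via-chord _ _ refl = constant _ _

      s<p : s < p
      s<p = <-trans (n<1+n s) 1+s<p

      complement : ∀ {a b} → a < b → ∃ λ w → w + a ≡ b × 0 < w
      complement {a} a<b with m≤n⇒∃[o]m+o≡n a<b
      ... | w , eq = suc w , trans (cong suc (+-comm w a)) eq , s≤s z≤n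

      cross₁ : ∀ a b → a < s → s + b < p → suc (a + b) ≡ ℓ → f a ≡ f (s + b)
      cross₁ a b a<s s+b<p ℓ≡ = via-chord a b ℓ≡ (join (down 0 a (<-trans a<s s<p))
        (subst (R (c 0)) (≡.sym (c-0+ s)) chord)
        (up s b (≤-<-trans (m≤n+m b s) s+b<p)) (inj₁ (a<s , s+b<p)))

      shift-ℓ : ∀ {x y} → x + ℓ ≡ y → f x ≡ f y
      shift-ℓ {x} refl = ≡.sym (per-ℓ x)

      -- The path climbs from `u = s - a` to `s`, takes the chord backwards to `p`, and descends to
      -- `q = p - b`. Moving both ends forward by the period `ℓ` turns them into `s + b + 1` and
      -- `p + a + 1`.
      cross₂ : ∀ a b → a < s → s + b < p → suc (a + b) ≡ ℓ → f (suc a) ≡ f (suc (s + b))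
      cross₂ a b a<s s+b<p ℓ≡ with complement a<s | complement (≤-<-trans (m≤n+m b s) s+b<p)
      ... | u , u+a≡s , 0<u | q , q+b≡p , _ = begin
        f (suc a)        ≡⟨ per-p (suc a) ⟨
        f (suc a + p)    ≡⟨ shift-ℓ (trans (cong (q +_) (≡.sym ℓ≡)) (trans (regroup₁ q a b) (cong (suc a +_) q+b≡p))) ⟨
        f q              ≡⟨ cong χ (c-0+ q) ⟨
        f (q + 0)        ≡⟨ via-chord a b ℓ≡ (join
                              (subst (Arc u a (c (u + 0)) ∘ c) u+a≡s (up u a (<-trans a<s s<p)))
                              (subst (R (c s)) (≡.sym (trans (cong c q+b≡p) (periodic 0))) (R-sym chord))
                              (down q b (≤-<-trans (m≤n+m b s) s+b<p))
                              (inj₁ ( subst (_< q) (≡.sym u+a≡s) (+-cancelʳ-< b _ _ (subst (s + b <_) (≡.sym q+b≡p) s+b<p))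
                                    , subst (_< u + p) (≡.sym q+b≡p) (m<n+m p 0<u)))) ⟨
        f (u + 0)        ≡⟨ cong χ (c-0+ u) ⟩
        f u              ≡⟨ shift-ℓ (trans (cong (u +_) (≡.sym ℓ≡)) (trans (regroup₂ u a b) (cong (λ z → suc (z + b)) u+a≡s))) ⟩
        f (suc (s + b))  ∎
        where
        open ≡-Reasoning
        regroup₁ : ∀ q a b → q + suc (a + b) ≡ suc a + (q + b)
        regroup₁ = solve-∀
        regroup₂ : ∀ u a b → u + suc (a + b) ≡ suc (u + a + b)
        regroup₂ = solve-∀

      -- The path climbs from `q = p - a` to `p`, takes the chord to `s`, and climbs on to `s + b`;
      -- `s + ℓ ≤ p` keeps `s + b` below `q`. The period `ℓ` moves `q` to `p + b + 1`.
      parallel₁ : s + ℓ ≤ p → ∀ b → b < ℓ → f (suc b) ≡ f (s + b)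
      parallel₁ s+ℓ≤p b b<ℓ with m≤n⇒∃[o]m+o≡n b<ℓ
      ... | a , b+a≡ with complement {a} (≤-<-trans (≤-trans (m≤n+m a (suc b)) (≤-reflexive b+a≡)) ℓ<p)
      ...   | q , q+a≡p , _ = begin
        f (suc b)        ≡⟨ per-p (suc b) ⟨
        f (suc b + p)    ≡⟨ shift-ℓ (trans (cong (q +_) (≡.sym b+a≡)) (trans (regroup q a b) (cong (suc b +_) q+a≡p))) ⟨
        f q              ≡⟨ cong χ (c-0+ q) ⟨
        f (q + 0)        ≡⟨ via-chord a b (trans (cong suc (+-comm a b)) b+a≡) (join
                              (up q a a<p)
                              (subst (λ v → R v (c (s + 0))) (≡.sym (trans (cong c q+a≡p) (periodic 0)))
                                 (subst (R (c 0)) (≡.sym (c-0+ s)) chord))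
                              (up s b b<p)
                              (inj₂ ( +-cancelʳ-< a _ _ (<-≤-trans (≤-reflexive (trans (regroup′ s a b) (cong (s +_) b+a≡)))
                                                          (≤-trans s+ℓ≤p (≤-reflexive (≡.sym q+a≡p))))
                                    , subst (_< s + p) (≡.sym q+a≡p) (m<n+m p (<-trans (s≤s z≤n) 1<s))))) ⟩
        f (s + b)        ∎
        where
        open ≡-Reasoning
        a<p : a < p
        a<p = ≤-<-trans (≤-trans (m≤n+m a (suc b)) (≤-reflexive b+a≡)) ℓ<p
        b<p : b < p
        b<p = <-trans b<ℓ ℓ<p
        regroup : ∀ q a b → q + (suc b + a) ≡ suc b + (q + a)
        regroup = solve-∀
        regroup′ : ∀ s a b → suc (s + b + a) ≡ s + (suc b + a)
        regroup′ = solve-∀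

      -- The path descends from `a` to 0, takes the chord to `s`, and descends to `u = s - b`;
      -- `ℓ ≤ s` keeps `a` below `u`. The period `ℓ` moves `u` to `s + a + 1`.
      parallel₂ : ℓ ≤ s → ∀ a → a < ℓ → f a ≡ f (suc (s + a))
      parallel₂ ℓ≤s a a<ℓ with m≤n⇒∃[o]m+o≡n a<ℓ
      ... | b , a+b≡ with complement {b} (<-≤-trans (≤-trans (s≤s (m≤n+m b a)) (≤-reflexive a+b≡)) ℓ≤s)
      ...   | u , u+b≡s , _ = begin
        f a              ≡⟨ via-chord a b a+b≡ (join
                              (down 0 a (<-trans a<ℓ ℓ<p))
                              (subst (R (c 0) ∘ c) (≡.sym u+b≡s) chord)
                              (down u b (≤-<-trans (≤-trans (m≤n+m b u) (≤-reflexive u+b≡s)) s<p))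
                              (inj₁ ( +-cancelʳ-< b _ _ (≤-trans (≤-reflexive a+b≡) (≤-trans ℓ≤s (≤-reflexive (≡.sym u+b≡s))))
                                    , subst (_< p) (≡.sym u+b≡s) s<p))) ⟩
        f (u + 0)        ≡⟨ cong χ (c-0+ u) ⟩
        f u              ≡⟨ shift-ℓ (trans (cong (u +_) (≡.sym a+b≡)) (trans (regroup u a b) (cong (λ z → suc (z + a)) u+b≡s))) ⟩
        f (suc (s + a))  ∎
        where
        open ≡-Reasoning
        regroup : ∀ u a b → u + (suc a + b) ≡ suc (u + b + a)
        regroup = solve-∀

    -- The lemma of Bondy and Simonovits in contrapositive form: a colouring that agrees at the ends
    -- of every path of length `ℓ` between cycle vertices at most alternates around the cycle.
    colouring-period-2 : Period f 2
    colouring-period-2 = chord-periods⇒period-2 {f = f} cross₁ cross₂ 1≤ℓ ℓ<p 1<s 1+s<p per-p per-ℓ parallel₁ parallel₂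

-- Layers

_⊆ᴳ_ : Graph n → Graph n → Set
H ⊆ᴳ G = ∀ {u v} → Adj H u v → Adj G u v

HasCycle-mono : {H G : Graph n} → H ⊆ᴳ G → ∀ {m} → HasCycle H m → HasCycle G m
HasCycle-mono H⊆G (3≤m , c , c-inj , c-adj) = 3≤m , c , c-inj , λ i j next → H⊆G (c-adj i j next)

Adj-sym : (G : Graph n) → ∀ {u v} → Adj G u v → Adj G v u
Adj-sym G {u} {v} uv = trans (Graph.sym G v u) uv

∧-true : ∀ {a b} → a ∧ b ≡ true → a ≡ true × b ≡ true
∧-true {true} {true} refl = refl , refl

∧-intro : ∀ {a b} → a ≡ true → b ≡ true → a ∧ b ≡ true
∧-intro refl refl = refl

restrict : Graph n → (Fin n → Bool) → Graph n
restrict G S = record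
  { adj    = λ u v → (S u ∧ S v) ∧ adj G u v
  ; sym    = λ u v → cong₂ _∧_ (∧-comm (S u) (S v)) (Graph.sym G u v)
  ; irrefl = λ v → trans (cong ((S v ∧ S v) ∧_) (irrefl G v)) (Bool.∧-zeroʳ _)
  }

restrict-⊆ : (G : Graph n) (S : Fin n → Bool) → restrict G S ⊆ᴳ G
restrict-⊆ G S = proj₂ ∘ ∧-true

deg-restrict : (G : Graph n) (S : Fin n → Bool) → ∀ v → S v ≡ true → deg G S v ≡ count (adj (restrict G S) v)
deg-restrict G S v Sv = sum-cong-≗ pointwise
  where
  pointwise : ∀ u → ind (S u) * ind (adj G v u) ≡ ind ((S v ∧ S u) ∧ adj G v u)
  pointwise u rewrite Sv with S u | adj G v u
  ... | true  | true  = refl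
  ... | true  | false = refl
  ... | false | _     = refl

-- Nothing is said about distances or about edges inside a layer: disjoint layers and one parent per
-- vertex are all that the cycle constructions use. `parent t` is meaningful only on layer `suc t`.
record Layering (G : Graph n) : Set where
  field
    root      : Fin n
    layer     : ℕ → Fin n → Bool
    layer-0   : ∀ {v} → layer 0 v ≡ true → v ≡ root
    disjoint  : ∀ {s t v} → layer s v ≡ true → layer t v ≡ true → s ≡ t
    parent    : ℕ → Fin n → Fin n
    parent-layer : ∀ {t v} → layer (suc t) v ≡ true → layer t (parent t v) ≡ true
    parent-adj   : ∀ {t v} → layer (suc t) v ≡ true → Adj G (parent t v) v

module _ {G : Graph n} (Λ : Layering G) where

  open Layering Λ

  -- The first argument is the layer of `v`, the last the number of steps towards the root. At layer
  -- 0 further steps stay put.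
  ancestor : ℕ → Fin n → ℕ → Fin n
  ancestor _       v zero    = v
  ancestor zero    v (suc h) = v
  ancestor (suc t) v (suc h) = ancestor t (parent t v) h

  ancestor-layer : ∀ {t v} h j → h + j ≡ t → layer t v ≡ true → layer j (ancestor t v h) ≡ true
  ancestor-layer         zero    j refl Lv = Lv
  ancestor-layer {suc t} (suc h) j eq   Lv = ancestor-layer h j (suc-injective eq) (parent-layer Lv)

  ancestor-adj : ∀ {t v} h → h < t → layer t v ≡ true → Adj G (ancestor t v (suc h)) (ancestor t v h)
  ancestor-adj {suc t} zero    _         Lv = parent-adj Lv
  ancestor-adj {suc t} (suc h) (s≤s h<t) Lv = ancestor-adj h h<t (parent-layer Lv)

  ancestor-merge-suc : ∀ t {a b} h → ancestor t a h ≡ ancestor t b h → ancestor t a (suc h) ≡ ancestor t b (suc h)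
  ancestor-merge-suc t       zero    refl = refl
  ancestor-merge-suc zero    (suc h) eq   = eq
  ancestor-merge-suc (suc t) (suc h) eq   = ancestor-merge-suc t h eq

  ancestor-merge : ∀ t {a b} h d → ancestor t a h ≡ ancestor t b h → ancestor t a (d + h) ≡ ancestor t b (d + h)
  ancestor-merge t h zero    eq = eq
  ancestor-merge t h (suc d) eq = ancestor-merge-suc t (d + h) (ancestor-merge t h d eq)

  ancestor-height : ∀ {t a b i j} → i ≤ t → j ≤ t → layer t a ≡ true → layer t b ≡ true →
    ancestor t a i ≡ ancestor t b j → i ≡ j
  ancestor-height {t} {a} {b} {i} {j} i≤t j≤t La Lb eq
    with m≤n⇒∃[o]m+o≡n i≤t | m≤n⇒∃[o]m+o≡n j≤t
  ... | i′ , i+i′≡t | j′ , j+j′≡t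
    with disjoint (ancestor-layer i i′ i+i′≡t La)
                  (subst (λ v → layer j′ v ≡ true) (≡.sym eq) (ancestor-layer j j′ j+j′≡t Lb))
  ...   | refl = +-cancelʳ-≡ i′ i j (trans i+i′≡t (≡.sym j+j′≡t))

  ancestor-root : ∀ {t v} → layer t v ≡ true → ancestor t v t ≡ root
  ancestor-root {t} Lv = layer-0 (ancestor-layer t 0 (+-identityʳ t) Lv)

  module _ {t : ℕ} {a b : Fin n} (La : layer t a ≡ true) (Lb : layer t b ≡ true)
           {h : ℕ} (h<t : h < t) (meet : ancestor t a (suc h) ≡ ancestor t b (suc h))
           (apart : ancestor t a h ≢ ancestor t b h)
           {ℓ : ℕ} (1≤ℓ : 1 ≤ ℓ) (w : Walk (Adj G) b a ℓ) (w-unique : Unique (vertices w))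
           (above : ∀ {v} → v ∈ vertices w → ∃ λ s → t ≤ s × layer s v ≡ true)
           where

    private
      lower : ∀ {c v i} → layer t c ≡ true → i < t → v ≡ ancestor t c (suc i) → ¬ v ∈ vertices w
      lower {i = i} Lc i<t refl v∈w with above v∈w | m≤n⇒∃[o]m+o≡n i<t
      ... | s , t≤s , Ls | j , i+j≡t with disjoint Ls (ancestor-layer (suc i) j i+j≡t Lc)
      ...   | refl = contradiction (≤-trans (m<n+m s (s≤s z≤n)) (≤-reflexive i+j≡t)) (≤⇒≯ t≤s)

      unique-branch : ∀ {c i j m} → layer t c ≡ true → m ≤ t → i < j → j < m →
        ancestor t c (suc i) ≢ ancestor t c (suc j)
      unique-branch Lc m≤t i<j j<m eq = <⇒≢ i<j (suc-injective
        (ancestor-height (≤-trans (<-trans i<j j<m) m≤t) (≤-trans j<m m≤t) Lc Lc eq))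

      right-edge : ∀ i → i < h → Adj G (ancestor t b (suc (suc i))) (ancestor t b (suc i))
      right-edge i i<h = ancestor-adj (suc i) (≤-<-trans i<h h<t) Lb

      right : Walk (Adj G) (ancestor t b (suc h)) (ancestor t b 1) h
      right = descend (λ i → ancestor t b (suc i)) h right-edge

      right-vertices : vertices right ≡ applyDownFrom (λ i → ancestor t b (suc i)) (suc h)
      right-vertices = vertices-descend _ h right-edge

      right∈ : ∀ {v} → v ∈ vertices right → ∃ λ i → i < suc h × v ≡ ancestor t b (suc i)
      right∈ v∈ = ∈-applyDownFrom⁻ _ (subst (_ ∈_) right-vertices v∈)

      first : Adj G (ancestor t b 1) b
      first = ancestor-adj 0 (≤-<-trans z≤n h<t) Lb

      upper : Walk (Adj G) (ancestor t b (suc h)) a (suc (h + ℓ))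
      upper = right ▷ first ▷ w

      upper-vertices : vertices upper ≡ vertices right ++ vertices w
      upper-vertices = vertices-▷ right first w

      upper-unique : Unique (vertices upper)
      upper-unique = subst Unique (≡.sym upper-vertices) (Unique.++⁺
        (subst Unique (≡.sym right-vertices) (Unique.applyDownFrom⁺₁ _ (suc h)
          (λ j<i i<h → unique-branch Lb h<t j<i i<h ∘ ≡.sym)))
        w-unique
        λ { (v∈right , v∈w) → let i , i<h , eq = right∈ v∈right in lower Lb (<-≤-trans i<h h<t) eq v∈w })

    -- The cycle runs from the common ancestor down to `b`, along `w` to `a`, and back up. The
    -- branches avoid `w` because they lie below layer `t`. They avoid each other because a common
    -- vertex has the same height on both, and merged branches stay merged, which contradicts
    -- `apart` at height `h`.
    branches⇒HasCycle : HasCycle G (2 * suc h + ℓ)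
    branches⇒HasCycle = close h refl
      where
      close : ∀ h′ → h ≡ h′ → HasCycle G (2 * suc h + ℓ)
      -- With `h = 0` the branch of `a` has no inner vertex, so `a` is adjacent to the common
      -- ancestor itself.
      close zero refl = closedWalk⇒HasCycle G upper upper-unique
        (subst (Adj G a) meet (Adj-sym G (ancestor-adj 0 h<t La))) (s≤s 1≤ℓ)
      close (suc h′) refl = subst (HasCycle G) (regroup h′ ℓ) (closedWalk⇒HasCycle G
        (upper ▷ Adj-sym G (ancestor-adj 0 0<t La) ▷ left)
        (subst Unique (≡.sym (vertices-▷ upper (Adj-sym G (ancestor-adj 0 0<t La)) left))
          (Unique.++⁺ upper-unique
            (subst Unique (≡.sym left-vertices) (Unique.applyUpTo⁺₁ _ h
              (λ i<j j<h → unique-branch La (<⇒≤ h<t) i<j j<h)))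
            left-apart))
        (subst (Adj G (ancestor t a h)) meet (Adj-sym G (ancestor-adj h h<t La)))
        (s≤s (s≤s z≤n)))
        where
        regroup : ∀ h′ ℓ → suc (suc (suc (suc h′ + ℓ) + h′)) ≡ 2 * suc (suc h′) + ℓ
        regroup = solve-∀
        0<t : 0 < t
        0<t = ≤-<-trans z≤n h<t
        left-edge : ∀ i → i < h′ → Adj G (ancestor t a (suc i)) (ancestor t a (suc (suc i)))
        left-edge i i<h′ = Adj-sym G (ancestor-adj (suc i) (<-trans (s≤s i<h′) h<t) La)
        left : Walk (Adj G) (ancestor t a 1) (ancestor t a h) h′
        left = ascend (λ i → ancestor t a (suc i)) h′ left-edge
        left-vertices : vertices left ≡ applyUpTo (λ i → ancestor t a (suc i)) h
        left-vertices = vertices-ascend _ h′ left-edge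
        left-right : ∀ {i j} → i < h → j < suc h → ancestor t a (suc i) ≢ ancestor t b (suc j)
        left-right {i} {j} i<h j<h eq
          with ancestor-height (<-trans i<h h<t) (≤-trans j<h h<t) La Lb eq
             | m≤n⇒∃[o]m+o≡n i<h
        ... | refl | d , i+d≡h = apart (subst (λ z → ancestor t a z ≡ ancestor t b z)
                                   (trans (+-comm d (suc i)) i+d≡h) (ancestor-merge t (suc i) d eq))
        left-apart : Disjoint (vertices upper) (vertices left)
        left-apart {v} (v∈upper , v∈left) with ∈-applyUpTo⁻ _ (subst (v ∈_) left-vertices v∈left)
        ... | i , i<h , v≡ with ∈-++⁻ (vertices right) (subst (v ∈_) upper-vertices v∈upper)
        ...   | inj₂ v∈w = lower La (<-trans i<h h<t) v≡ v∈w
        ...   | inj₁ v∈right with right∈ v∈right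
        ...     | j , j<h , v≡′ = left-right i<h j<h (trans (≡.sym v≡) v≡′)

  layerGraph : ℕ → Graph n
  layerGraph t = record
    { adj    = λ u v → adj G u v ∧ ((layer t u ∧ layer (suc t) v) ∨ (layer (suc t) u ∧ layer t v))
    ; sym    = λ u v → cong₂ _∧_ (Graph.sym G u v)
        (trans (∨-comm (layer t u ∧ layer (suc t) v) _)
               (cong₂ _∨_ (∧-comm (layer (suc t) u) (layer t v)) (∧-comm (layer t u) (layer (suc t) v))))
    ; irrefl = λ v → cong (_∧ _) (irrefl G v)
    }

  layerGraph-⊆ : ∀ t → layerGraph t ⊆ᴳ G
  layerGraph-⊆ t = proj₁ ∘ ∧-true

  layerGraph-ends : ∀ t {u v} → Adj (layerGraph t) u v →
    (layer t u ≡ true × layer (suc t) v ≡ true) ⊎ (layer (suc t) u ≡ true × layer t v ≡ true)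
  layerGraph-ends t {u} {v} uv with layer t u ∧ layer (suc t) v in eq | proj₂ (∧-true {adj G u v} uv)
  ... | true  | _ = inj₁ (∧-true eq)
  ... | false | p = inj₂ (∧-true p)

  layer-suc-false : ∀ t {v} → layer (suc t) v ≡ true → layer t v ≡ false
  layer-suc-false t {v} Lv with layer t v in eq
  ... | false = refl
  ... | true  = contradiction (≡.sym (disjoint eq Lv)) 1+n≢n

  layerGraph-alternates : ∀ t {u v} → Adj (layerGraph t) u v → layer t v ≡ not (layer t u)
  layerGraph-alternates t uv with layerGraph-ends t uv
  ... | inj₁ (Lu , Lv) = trans (layer-suc-false t Lv) (cong not (≡.sym Lu))
  ... | inj₂ (Lu , Lv) = trans Lv (cong not (≡.sym (layer-suc-false t Lu)))

  even-walk-layer : ∀ t w {x y} → Walk (Adj (layerGraph t)) x y (2 * w) → layer t y ≡ layer t x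
  even-walk-layer t w walk = trans (alternate walk) (flips-even w _)
    where
    flips : ℕ → Bool → Bool
    flips zero    b = b
    flips (suc m) b = flips m (not b)
    alternate : ∀ {m x y} → Walk (Adj (layerGraph t)) x y m → layer t y ≡ flips m (layer t x)
    alternate [ _ ] = refl
    alternate {suc m} (xz ∷ w) = trans (alternate w) (cong (flips m) (layerGraph-alternates t xz))
    flips-even : ∀ w b → flips (2 * w) b ≡ b
    flips-even zero    b = refl
    flips-even (suc w) b = trans (cong (λ m → flips m b) (*-suc 2 w))
      (trans (flips-even w (not (not b))) (not-involutive b))

  walk-above : ∀ t {x y m} (w : Walk (Adj (layerGraph t)) x y m) →
    (∃ λ s → t ≤ s × layer s x ≡ true) → ∀ {v} → v ∈ vertices w → ∃ λ s → t ≤ s × layer s v ≡ true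
  walk-above t [ x ]    Lx (here refl) = Lx
  walk-above t (_ ∷ w)  Lx (here refl) = Lx
  walk-above t (xz ∷ w) Lx (there v∈) with layerGraph-ends t xz
  ... | inj₁ (_ , Lz) = walk-above t w (suc t , n≤1+n t , Lz) v∈
  ... | inj₂ (_ , Lz) = walk-above t w (t , ≤-refl , Lz) v∈

  module _ {k t : ℕ} (t<k : t < k) (no-2k : ¬ HasCycle G (2 * k))
           {p s : ℕ} (C : ChordedCycle (Adj (layerGraph t)) p s) (2k≤p : 2 * k ≤ p) where

    open ChordedCycle C

    private
      -- Off layer `t` the colour is a constant, so paths of even length between vertices of layer
      -- `suc t` satisfy the colouring condition trivially.
      χ : ℕ → Fin n → Fin n
      χ h v = if layer t v then ancestor t v h else root

      χ-true : ∀ h {v} → layer t v ≡ true → χ h v ≡ ancestor t v h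
      χ-true h Lv rewrite Lv = refl

      χ-false : ∀ h {v} → layer t v ≡ false → χ h v ≡ root
      χ-false h Lv rewrite Lv = refl

      χ-top : ∀ v → χ t v ≡ root
      χ-top v with layer t v in Lv
      ... | true  = ancestor-root Lv
      ... | false = refl

      alternate : ∀ i → layer t (c (suc i)) ≡ not (layer t (c i))
      alternate i = layerGraph-alternates t (edge i)

      alternate² : ∀ i → layer t (c (i + 2)) ≡ layer t (c i)
      alternate² i = trans (cong (layer t ∘ c) (+-comm i 2))
        (trans (alternate (suc i)) (trans (cong not (alternate i)) (not-involutive _)))

      -- An even number of steps keeps the colour by periodicity, an odd number changes the layer.
      -- Two cycle vertices in layer `t` therefore fall under the first alternative.
      parity : ∀ h → Period (χ h ∘ c) 2 → ∀ i d →
        χ h (c (d + i)) ≡ χ h (c i) ⊎ layer t (c (d + i)) ≡ not (layer t (c i))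
      parity h per i zero          = inj₁ refl
      parity h per i (suc zero)    = inj₂ (alternate i)
      parity h per i (suc (suc d)) with parity h per i d
      ... | inj₁ eq = inj₁ (trans (cong (χ h ∘ c) (+-comm 2 (d + i))) (trans (per (d + i)) eq))
      ... | inj₂ eq = inj₂ (trans (cong (layer t ∘ c) (+-comm 2 (d + i))) (trans (alternate² (d + i)) eq))

      uniform-≤ : ∀ h → Period (χ h ∘ c) 2 → ∀ {i j} → i ≤ j →
        layer t (c i) ≡ true → layer t (c j) ≡ true → ancestor t (c i) h ≡ ancestor t (c j) h
      uniform-≤ h per {i} i≤j Li Lj with m≤n⇒∃[o]m+o≡n i≤j
      ... | d , refl rewrite +-comm i d with parity h per i d
      ...   | inj₁ eq = trans (≡.sym (χ-true h Li)) (trans (≡.sym eq) (χ-true h Lj))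
      ...   | inj₂ eq = contradiction (trans (≡.sym Lj) (trans eq (cong not Li))) λ ()

      uniform : ∀ h → Period (χ h ∘ c) 2 → ∀ i j →
        layer t (c i) ≡ true → layer t (c j) ≡ true → ancestor t (c i) h ≡ ancestor t (c j) h
      uniform h per i j Li Lj with ≤-total i j
      ... | inj₁ i≤j = uniform-≤ h per i≤j Li Lj
      ... | inj₂ j≤i = ≡.sym (uniform-≤ h per j≤i Lj Li)

      descend-colour : ∀ h → h < t → Period (χ (suc h) ∘ c) 2 → Period (χ h ∘ c) 2
      -- `w` is `k - h - 1`, so `2 * w` is at least 2 and below `2 * k ≤ p`; the two branches supply
      -- the missing `2 * suc h` edges.
      descend-colour h h<t per with m≤n⇒∃[o]m+o≡n (<-trans h<t t<k)
      ... | w , eq = colouring-period-2 (Adj-sym (layerGraph t)) C (χ h) (≤-trans (s≤s z≤n) 2≤ℓ) ℓ<p constant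
        where
        1≤w : 1 ≤ w
        1≤w = +-cancelˡ-< (suc h) 0 w (subst (suc h + 0 <_) (≡.sym eq)
          (subst (_< k) (≡.sym (+-identityʳ (suc h))) (≤-<-trans h<t t<k)))
        2≤ℓ : 2 ≤ 2 * w
        2≤ℓ = *-monoʳ-≤ 2 1≤w
        ℓ<p : 2 * w < p
        ℓ<p = <-≤-trans (*-monoʳ-< 2 (subst (w <_) eq (m<n+m w (s≤s z≤n)))) 2k≤p
        constant : ∀ i j → Joined (Adj (layerGraph t)) (2 * w) (c i) (c j) → χ h (c i) ≡ χ h (c j)
        constant i j (walk , unique) = by-layer (layer t (c i)) refl
          where
          same : layer t (c j) ≡ layer t (c i)
          same = even-walk-layer t w walk
          by-layer : ∀ b → layer t (c i) ≡ b → χ h (c i) ≡ χ h (c j)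
          by-layer false Li = trans (χ-false h Li) (≡.sym (χ-false h (trans same Li)))
          by-layer true  Li = trans (χ-true h Li) (trans (decidable-stable (_ ≟ _) equal) (≡.sym (χ-true h Lj)))
            where
            Lj : layer t (c j) ≡ true
            Lj = trans same Li
            walk′ : Walk (Adj G) (c i) (c j) (2 * w)
            walk′ = mapWalk (layerGraph-⊆ t) walk
            vertices′ : vertices walk′ ≡ vertices walk
            vertices′ = vertices-map (layerGraph-⊆ t) walk
            equal : ¬ ancestor t (c i) h ≢ ancestor t (c j) h
            equal apart = no-2k (subst (HasCycle G)
              (trans (≡.sym (*-distribˡ-+ 2 (suc h) w)) (cong (2 *_) eq))
              (branches⇒HasCycle Lj Li h<t (uniform (suc h) per j i Lj Li) (apart ∘ ≡.sym)
                (≤-trans (s≤s z≤n) 2≤ℓ) walk′ (subst Unique (≡.sym vertices′) unique)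
                (λ v∈ → walk-above t walk (t , ≤-refl , Li) (subst (_ ∈_) vertices′ v∈))))

      all-periods : ∀ d h → d + h ≡ t → Period (χ h ∘ c) 2
      all-periods zero    h refl i = trans (χ-top _) (≡.sym (χ-top _))
      all-periods (suc d) h eq = descend-colour h (subst (h <_) eq (m<n+m h (s≤s z≤n)))
        (all-periods d (suc h) (trans (+-suc d h) eq))

    chordedCycle⇒HasCycle-2k : ⊥
    chordedCycle⇒HasCycle-2k = by-layer (layer t (c 0)) refl
      where
      -- At height 0 uniformity reads `c i ≡ c (i + 2)`, although the cycle is longer than 2.
      impossible : ∀ i → layer t (c i) ≡ true → ⊥
      impossible i Li = distinct {i} {i + 2} (m<m+n i (s≤s z≤n)) (+-monoʳ-< i (≤-<-trans 1<s (<-trans (n<1+n s) 1+s<p)))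
        (uniform 0 (all-periods t 0 (+-identityʳ t)) i (i + 2) Li (trans (alternate² i) Li))
      by-layer : ∀ b → layer t (c 0) ≡ b → ⊥
      by-layer true  L0 = impossible 0 L0
      by-layer false L0 = impossible 1 (trans (alternate 0) (cong not L0))

-- Long cycles from minimum degree

record IndexedPath (G : Graph n) (q : ℕ) : Set where
  field
    x        : ℕ → Fin n
    edge     : ∀ {i} → i < q → Adj G (x i) (x (suc i))
    distinct : ∀ {i j} → i ≤ q → j ≤ q → x i ≡ x j → i ≡ j

open IndexedPath

path-length< : {G : Graph n} → ∀ {q} → IndexedPath G q → q < n
path-length< {q = q} π = injective⇒≤ {f = x π ∘ toℕ {suc q}} λ eq →
  toℕ-injective (distinct π (≤-pred (toℕ<n _)) (≤-pred (toℕ<n _)) eq)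

-- Paths are extended at their first vertex. A path on distinct vertices has fewer than `n` edges,
-- so `n` bounds the extensions. `P` travels along to keep the degree condition available at the new
-- first vertex.
maximalPath : (G : Graph n) (P : Fin n → Set) → (∀ {u v} → Adj G u v → P v) → ∀ {v} → P v →
  ∃ λ q → Σ (IndexedPath G q) λ π → P (x π 0) × (∀ u → Adj G (x π 0) u → ∃ λ i → i ≤ q × x π i ≡ u)
maximalPath {n} G P P-adj {v} Pv = extend n 0 (m≤m+n n 0) trivial Pv
  where
  trivial : IndexedPath G 0
  trivial = record { x = λ _ → v ; edge = λ () ; distinct = λ { z≤n z≤n _ → refl } }

  cons : ∀ {q} (π : IndexedPath G q) u → Adj G (x π 0) u → (∀ i → i ≤ q → x π i ≢ u) → IndexedPath G (suc q)
  cons {q} π u xu fresh = record { x = y ; edge = y-edge ; distinct = y-distinct }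
    where
    y : ℕ → Fin n
    y zero    = u
    y (suc i) = x π i
    y-edge : ∀ {i} → i < suc q → Adj G (y i) (y (suc i))
    y-edge {zero}  _         = Adj-sym G xu
    y-edge {suc i} (s≤s i<q) = edge π i<q
    y-distinct : ∀ {i j} → i ≤ suc q → j ≤ suc q → y i ≡ y j → i ≡ j
    y-distinct {zero}  {zero}  _ _ _ = refl
    y-distinct {zero}  {suc j} _ (s≤s j≤q) eq = contradiction (≡.sym eq) (fresh j j≤q)
    y-distinct {suc i} {zero}  (s≤s i≤q) _ eq = contradiction eq (fresh i i≤q)
    y-distinct {suc i} {suc j} (s≤s i≤q) (s≤s j≤q) eq = cong suc (distinct π i≤q j≤q eq)

  extend : ∀ fuel q → n ≤ fuel + q → (π : IndexedPath G q) → P (x π 0) →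
    ∃ λ q → Σ (IndexedPath G q) λ π → P (x π 0) × (∀ u → Adj G (x π 0) u → ∃ λ i → i ≤ q × x π i ≡ u)
  extend zero       q n≤q π Px = contradiction (path-length< π) (≤⇒≯ n≤q)
  extend (suc fuel) q n≤  π Px
    with any? (λ u → (adj G (x π 0) u Bool.≟ true) ×-dec all? {n = suc q} (λ i → ¬? (x π (toℕ i) ≟ u)))
  ... | yes (u , xu , fresh) = extend fuel (suc q) (≤-trans n≤ (≤-reflexive (≡.sym (+-suc fuel q))))
    (cons π u xu λ i i≤q eq → fresh (fromℕ< (s≤s i≤q)) (trans (cong (x π) (toℕ-fromℕ< (s≤s i≤q))) eq)) (P-adj xu)
  ... | no maximal = q , π , Px , λ u xu → on-path u xu
    where
    on-path : ∀ u → Adj G (x π 0) u → ∃ λ i → i ≤ q × x π i ≡ u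
    on-path u xu with any? {n = suc q} (λ i → x π (toℕ i) ≟ u)
    ... | yes (i , eq) = toℕ i , ≤-pred (toℕ<n i) , eq
    ... | no  fresh    = contradiction (u , xu , λ i eq → fresh (i , eq)) maximal

largest : {P : ℕ → Set} → (∀ i → Dec (P i)) → ∀ q {i} → i ≤ q → P i →
  ∃ λ s → P s × s ≤ q × (∀ {j} → j ≤ q → P j → j ≤ s)
largest P? zero    z≤n Pi = 0 , Pi , z≤n , λ j≤0 _ → j≤0
largest P? (suc q) i≤ Pi with P? (suc q)
... | yes Pq = suc q , Pq , ≤-refl , λ j≤ _ → j≤
... | no ¬Pq with m≤n⇒m<n∨m≡n i≤
...   | inj₂ refl = contradiction Pi ¬Pq
...   | inj₁ (s≤s i≤q) with largest P? q i≤q Pi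
...     | s , Ps , s≤q , max = s , Ps , m≤n⇒m≤1+n s≤q , max′
  where
  max′ : ∀ {j} → j ≤ suc q → _ → j ≤ s
  max′ j≤ Pj with m≤n⇒m<n∨m≡n j≤
  ... | inj₂ refl = contradiction Pj ¬Pq
  ... | inj₁ (s≤s j≤q) = max j≤q Pj

module _ {G : Graph n} {q : ℕ} (π : IndexedPath G q) where

  path-chord⇒HasCycle : ∀ {i j} → 1 ≤ i → i < j → j ≤ q → Adj G (x π 0) (x π i) → Adj G (x π 0) (x π j) →
    HasCycle G (2 + (j ∸ i))
  path-chord⇒HasCycle {i} {j} 1≤i i<j j≤q 0i 0j with m≤n⇒∃[o]m+o≡n (<⇒≤ i<j)
  ... | d , refl rewrite m+n∸m≡n i d = closedWalk⇒HasCycle G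
    (start ∷ walk)
    (subst (λ vs → Unique (x π 0 ∷ vs)) (≡.sym (vertices-ascend f d step))
      (fresh ∷ Unique.applyUpTo⁺₁ f (suc d) λ a<b b≤d eq →
        <⇒≢ (+-monoʳ-< i a<b) (distinct π (below (<⇒≤ (<-≤-trans a<b (≤-pred b≤d)))) (below (≤-pred b≤d)) eq)))
    (Adj-sym G 0j)
    (s≤s (+-cancelˡ-< i 0 d (subst (_< i + d) (≡.sym (+-identityʳ i)) i<j)))
    where
    f : ℕ → Fin n
    f a = x π (i + a)
    below : ∀ {a} → a ≤ d → i + a ≤ q
    below a≤d = ≤-trans (+-monoʳ-≤ i a≤d) j≤q
    step : ∀ a → a < d → Adj G (f a) (f (suc a))
    step a a<d = subst (λ z → Adj G (f a) (x π z)) (≡.sym (+-suc i a))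
      (edge π (≤-trans (+-monoʳ-< i a<d) j≤q))
    walk = ascend f d step
    start : Adj G (x π 0) (f 0)
    start = subst (Adj G (x π 0) ∘ x π) (≡.sym (+-identityʳ i)) 0i
    fresh : All (x π 0 ≢_) (applyUpTo f (suc d))
    fresh = All.tabulate λ v∈ eq → let a , a≤d , v≡ = ∈-applyUpTo⁻ f v∈ in
      <⇒≢ (≤-trans 1≤i (m≤m+n i a)) (distinct π z≤n (below (≤-pred a≤d)) (trans eq v≡))

  close-path : ∀ {s t} → s ≤ q → 1 < t → t < s → Adj G (x π 0) (x π s) → Adj G (x π 0) (x π t) →
    ChordedCycle (Adj G) (suc s) t
  close-path {s} {t} s≤q 1<t t<s 0s 0t = record
    { c        = c
    ; periodic = λ i → cong (x π) ([m+n]%n≡m%n i (suc s))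
    ; edge     = c-edge
    ; distinct = c-distinct
    ; chord    = subst (λ z → Adj G (c 0) (x π z)) (≡.sym (m<n⇒m%n≡m (m<n⇒m<1+n t<s))) 0t
    ; 1<s      = 1<t
    ; 1+s<p    = s≤s t<s
    }
    where
    c : ℕ → Fin n
    c i = x π (i % suc s)
    suc-% : ∀ i → suc i % suc s ≡ suc (i % suc s) % suc s
    suc-% i = trans (cong (λ z → suc z % suc s) (m≡m%n+[m/n]*n i (suc s)))
      ([m+kn]%n≡m%n (suc (i % suc s)) (i / suc s) (suc s))
    c-edge : ∀ i → Adj G (c i) (c (suc i))
    c-edge i with m≤n⇒m<n∨m≡n (≤-pred (m%n<n i (suc s)))
    ... | inj₁ r<s = subst (λ z → Adj G (c i) (x π z))
      (≡.sym (trans (suc-% i) (m<n⇒m%n≡m (s≤s r<s)))) (edge π (<-≤-trans r<s s≤q))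
    ... | inj₂ r≡s = ≡.subst₂ (λ y z → Adj G (x π y) (x π z)) (≡.sym r≡s)
      (≡.sym (trans (suc-% i) (trans (cong (λ z → suc z % suc s) r≡s) (n%n≡0 (suc s))))) (Adj-sym G 0s)
    -- Equal vertices have equal remainders. A larger quotient then puts `j` at least `p` beyond
    -- `i`, any other puts it at or below `i`.
    c-distinct : ∀ {i j} → i < j → j < i + suc s → c i ≢ c j
    c-distinct {i} {j} i<j j<i+p eq = by-quotient (<-≤-connex (i / p) (j / p))
      where
      p = suc s
      r≡ : i % p ≡ j % p
      r≡ = distinct π (≤-trans (≤-pred (m%n<n i p)) s≤q) (≤-trans (≤-pred (m%n<n j p)) s≤q) eq
      i≡ : i ≡ j % p + (i / p) * p
      i≡ = trans (m≡m%n+[m/n]*n i p) (cong (_+ (i / p) * p) r≡)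
      j≡ = m≡m%n+[m/n]*n j p
      by-quotient : i / p < j / p ⊎ j / p ≤ i / p → ⊥
      by-quotient (inj₁ lt) = <⇒≱ j<i+p (begin
        i + p                          ≡⟨ cong (_+ p) i≡ ⟩
        j % p + (i / p) * p + p        ≡⟨ regroup (j % p) (i / p) p ⟩
        j % p + suc (i / p) * p        ≤⟨ +-monoʳ-≤ (j % p) (*-monoˡ-≤ p lt) ⟩
        j % p + (j / p) * p            ≡⟨ j≡ ⟨
        j                              ∎)
        where
        open ≤-Reasoning
        regroup : ∀ a b p → a + b * p + p ≡ a + suc b * p
        regroup = solve-∀
      by-quotient (inj₂ le) = <⇒≱ i<j (begin
        j                              ≡⟨ j≡ ⟩
        j % p + (j / p) * p            ≤⟨ +-monoʳ-≤ (j % p) (*-monoˡ-≤ p le) ⟩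
        j % p + (i / p) * p            ≡⟨ i≡ ⟨
        i                              ∎)
        where open ≤-Reasoning

/-≡⇒< : ∀ {i j D} .{{_ : NonZero D}} → i / D ≡ j / D → j < D + i
/-≡⇒< {i} {j} {D} eq = begin-strict
  j                       ≡⟨ m≡m%n+[m/n]*n j D ⟩
  j % D + (j / D) * D     <⟨ +-monoˡ-< ((j / D) * D) (m%n<n j D) ⟩
  D + (j / D) * D         ≡⟨ cong (λ z → D + z * D) eq ⟨
  D + (i / D) * D         ≤⟨ +-monoʳ-≤ D (≤-trans (m≤n+m _ (i % D)) (≤-reflexive (≡.sym (m≡m%n+[m/n]*n i D)))) ⟩
  D + i                   ∎
  where open ≤-Reasoning

-- The neighbours of the first vertex of a longest path lie on it, at most one in each block of D consecutive
-- positions, so the last of them closes a cycle through more than r blocks.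
minDegree⇒chordedCycle : (G : Graph n) (P : Fin n → Set) → (∀ {u v} → Adj G u v → P v) → ∀ {v} → P v →
  ∀ {r D} → 2 ≤ r → 1 ≤ D → (∀ {v} → P v → r < count (adj G v)) → (∀ {m} → m < 2 + D → ¬ HasCycle G m) →
  ∃₂ λ p s → 2 + r * D ≤ p × ChordedCycle (Adj G) p s
minDegree⇒chordedCycle {n} G P P-adj Pv {r} {suc D′} 2≤r 1≤D min-deg no-short
  with maximalPath G P P-adj Pv
... | q , π , Px , on-path = build
  where
  D = suc D′
  a = x π 0
  index : Fin n → ℕ
  index u with any? {n = suc q} (λ i → x π (toℕ i) ≟ u)
  ... | yes (i , _) = toℕ i
  ... | no  _       = 0
  index-spec : ∀ {u} → Adj G a u → index u ≤ q × x π (index u) ≡ u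
  index-spec {u} au with any? {n = suc q} (λ i → x π (toℕ i) ≟ u)
  ... | yes (i , eq) = ≤-pred (toℕ<n i) , eq
  ... | no  off with on-path u au
  ...   | i , i≤q , eq = contradiction
    (fromℕ< (s≤s i≤q) , trans (cong (x π) (toℕ-fromℕ< (s≤s i≤q))) eq) off
  index-positive : ∀ {u} → Adj G a u → 1 ≤ index u
  index-positive {u} au with index u | index-spec au
  ... | suc _ | _        = s≤s z≤n
  ... | zero  | _ , refl = contradiction (trans (≡.sym au) (irrefl G a)) λ ()
  index-adj : ∀ {u} → Adj G a u → Adj G a (x π (index u))
  index-adj au = subst (Adj G a) (≡.sym (proj₂ (index-spec au))) au
  index-injective : ∀ {u v} → Adj G a u → Adj G a v → index u ≡ index v → u ≡ v
  index-injective au av eq = trans (≡.sym (proj₂ (index-spec au))) (trans (cong (x π) eq) (proj₂ (index-spec av)))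

  a-neighbour : ∃ λ u → Adj G a u
  a-neighbour with sum-positive _ (≤-<-trans z≤n (min-deg Px))
  ... | u , 0<au with adj G a u in eq
  ...   | true  = u , eq
  ...   | false = contradiction 0<au λ ()

  last-neighbour : ∃ λ s → Adj G a (x π s) × s ≤ q × (∀ {j} → j ≤ q → Adj G a (x π j) → j ≤ s)
  last-neighbour = largest (λ i → adj G a (x π i) Bool.≟ true) q
    (proj₁ (index-spec (proj₂ a-neighbour))) (index-adj (proj₂ a-neighbour))

  s = proj₁ last-neighbour
  as = proj₁ (proj₂ last-neighbour)
  s≤q = proj₁ (proj₂ (proj₂ last-neighbour))
  index≤s : ∀ {u} → Adj G a u → index u ≤ s
  index≤s au = proj₂ (proj₂ (proj₂ last-neighbour)) (proj₁ (index-spec au)) (index-adj au)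

  pred+1 : ∀ {i} → 1 ≤ i → suc (i ∸ 1) ≡ i
  pred+1 (s≤s _) = refl

  -- Neighbours occupy positions from 1 on, so blocks are counted from `index u ∸ 1`. Two neighbours
  -- in one block are fewer than `D` positions apart and close a cycle shorter than `2 + D`.
  same-block : ∀ {u v} → Adj G a u → Adj G a v → (index u ∸ 1) / D ≡ (index v ∸ 1) / D → ¬ index u < index v
  same-block {u} {v} au av eq u<v = no-short short
    (path-chord⇒HasCycle π (index-positive au) u<v (proj₁ (index-spec av)) (index-adj au) (index-adj av))
    where
    v< : index v < index u + D
    v< = ≡.subst₂ _<_ (pred+1 (index-positive av)) shifted (s≤s (/-≡⇒< {index u ∸ 1} eq))
      where
      shifted : suc (D + (index u ∸ 1)) ≡ index u + D
      shifted = trans (+-comm (suc D) (index u ∸ 1))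
        (trans (+-suc (index u ∸ 1) D) (cong (_+ D) (pred+1 (index-positive au))))
    short : 2 + (index v ∸ index u) < 2 + D
    short = s≤s (s≤s (+-cancelˡ-< (index u) _ _ (subst (_< index u + D) (≡.sym (m+[n∸m]≡n (<⇒≤ u<v))) v<)))

  long : r * D < s
  long = ≰⇒> λ s≤rD → let
      u , v , u≢v , au , av , eq = count-pigeonhole (adj G a) (λ u → (index u ∸ 1) / D) (min-deg Px)
        λ u au → m<n*o⇒m/o<n (subst (_≤ r * D) (≡.sym (pred+1 (index-positive au))) (≤-trans (index≤s au) s≤rD))
    in compare au av u≢v eq
    where
    compare : ∀ {u v} → Adj G a u → Adj G a v → u ≢ v → (index u ∸ 1) / D ≡ (index v ∸ 1) / D → ⊥
    compare {u} {v} au av u≢v eq with <-cmp (index u) (index v)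
    ... | tri< u<v _ _ = same-block au av eq u<v
    ... | tri≈ _ u≡v _ = u≢v (index-injective au av u≡v)
    ... | tri> _ _ v<u = same-block av au (≡.sym eq) v<u

  -- By `2 ≤ r` there are at least three neighbours. Without an inner one each sits at position 1 or
  -- `s`, and the pigeonhole principle on the test for `s` makes two coincide.
  inner-chord : ∃ λ t → 1 < t × t < s × Adj G a (x π t)
  inner-chord with any? {n = s} (λ t → (1 <? toℕ t) ×-dec (adj G a (x π (toℕ t)) Bool.≟ true))
  ... | yes (t , 1<t , at) = toℕ t , 1<t , toℕ<n t , at
  ... | no none = let
      u , v , u≢v , au , av , eq = count-pigeonhole (adj G a) (λ u → ind ⌊ index u ℕ.≟ s ⌋)
        (≤-<-trans 2≤r (min-deg Px)) λ u _ → ind<2 ⌊ index u ℕ.≟ s ⌋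
    in contradiction (index-injective au av (extreme au av eq)) u≢v
    where
    ind<2 : ∀ b → ind b < 2
    ind<2 true  = s≤s (s≤s z≤n)
    ind<2 false = s≤s z≤n
    one : ∀ {u} → Adj G a u → index u ≢ s → index u ≡ 1
    one {u} au u≢s = ≤-antisym (≮⇒≥ λ 1<u → none
      (fromℕ< u<s , subst (1 <_) (≡.sym (toℕ-fromℕ< u<s)) 1<u ,
        subst (Adj G a ∘ x π) (≡.sym (toℕ-fromℕ< u<s)) (index-adj au))) (index-positive au)
      where
      u<s : index u < s
      u<s = ≤∧≢⇒< (index≤s au) u≢s
    extreme : ∀ {u v} → Adj G a u → Adj G a v →
      ind ⌊ index u ℕ.≟ s ⌋ ≡ ind ⌊ index v ℕ.≟ s ⌋ → index u ≡ index v
    extreme {u} {v} au av eq with index u ℕ.≟ s | index v ℕ.≟ s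
    ... | yes u≡s | yes v≡s = trans u≡s (≡.sym v≡s)
    ... | no  u≢s | no  v≢s = trans (one au u≢s) (≡.sym (one av v≢s))
    extreme au av () | yes _ | no _
    extreme au av () | no _ | yes _

  build : ∃₂ λ p s → 2 + r * D ≤ p × ChordedCycle (Adj G) p s
  build with inner-chord
  ... | t , 1<t , t<s , at = suc s , t , s≤s long , close-path π s≤q 1<t t<s as at

-- Edges between consecutive layers

module _ {G : Graph n} (Λ : Layering G) where

  open Layering Λ

  layerSize : ℕ → ℕ
  layerSize t = count (layer t)

  layerEdge : ℕ → Fin n → Fin n → Bool
  layerEdge t u v = layer t u ∧ (layer (suc t) v ∧ adj G u v)

  layerEdges : ℕ → ℕ
  layerEdges t = sum (λ u → count (layerEdge t u))

  module _ {t : ℕ} (no-short : ∀ {h} → h < t → ¬ HasCycle G (2 * suc h + 2)) where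

    -- Two parents `a` and `b` of `v` are joined by the path through `v` of length 2. Their branches
    -- meet at the root; at the height where they first meet, the branches and this path would form
    -- one of the excluded cycles.
    unique-parent : ∀ {a b v} → layer t a ≡ true → layer t b ≡ true → layer (suc t) v ≡ true →
      Adj G a v → Adj G b v → a ≡ b
    unique-parent {a} {b} {v} La Lb Lv av bv = merged t 0 (+-identityʳ t)
      where
      below≢ : ∀ {u} → layer t u ≡ true → u ≢ v
      below≢ Lu refl = 1+n≢n (disjoint Lv Lu)
      merged : ∀ d h → d + h ≡ t → ancestor Λ t a h ≡ ancestor Λ t b h
      merged zero    h refl = trans (ancestor-root Λ La) (≡.sym (ancestor-root Λ Lb))
      merged (suc d) h eq = decidable-stable (_ ≟ _) λ apart → no-short h<t
        (branches⇒HasCycle Λ La Lb h<t (merged d (suc h) (trans (+-suc d h) eq)) apart (s≤s z≤n)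
          (bv ∷ Adj-sym G av ∷ [ a ])
          ((below≢ Lb ∷ (λ { refl → apart refl }) ∷ []) ∷ ((below≢ La ∘ ≡.sym) ∷ []) ∷ [] ∷ [])
          λ { (here refl) → t , ≤-refl , Lb
            ; (there (here refl)) → suc t , n≤1+n t , Lv
            ; (there (there (here refl))) → t , ≤-refl , La })
        where
        h<t : h < t
        h<t = subst (h <_) eq (m<n+m h (s≤s z≤n))

    layerEdges≤layerSize : layerEdges t ≤ layerSize (suc t)
    layerEdges≤layerSize = ≤-trans (≤-reflexive (∑-comm (λ u v → ind (layerEdge t u v)))) (sum-mono parents)
      where
      split : ∀ u v → layerEdge t u v ≡ true → layer t u ≡ true × layer (suc t) v ≡ true × Adj G u v
      split u v uv = let Lu , rest = ∧-true {layer t u} uv in Lu , ∧-true rest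
      parents : ∀ v → count (λ u → layerEdge t u v) ≤ ind (layer (suc t) v)
      parents v with layer (suc t) v in Lv
      ... | false = ≤-reflexive (sum-zero _ λ u → cong ind (Bool.∧-zeroʳ (layer t u)))
      ... | true = ≮⇒≥ λ 1<count → let
          a , b , a≢b , av , bv , _ = count-pigeonhole (λ u → layer t u ∧ (true ∧ adj G u v)) (λ _ → 0) 1<count (λ _ _ → s≤s z≤n)
          La , av′ = ∧-true {layer t a} av
          Lb , bv′ = ∧-true {layer t b} bv
        in a≢b (unique-parent La Lb Lv av′ bv′)

  module _ {k r D t : ℕ} (1≤r : 1 ≤ r) (1≤D : 1 ≤ D) (rD : 2 * k ≤ 2 + r * D) (t<k : t < k)
           (no-2k : ¬ HasCycle G (2 * k)) (no-short : ∀ {m} → m < 2 + D → ¬ HasCycle G m) where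

    private
      twoLayers : Fin n → Bool
      twoLayers v = layer t v ∨ layer (suc t) v

      twoLayers-count : count twoLayers ≤ layerSize t + layerSize (suc t)
      twoLayers-count = ≤-trans (sum-mono (λ v → ind-∨ (layer t v) _))
        (≤-reflexive (∑-distrib-+ (ind ∘ layer t) (ind ∘ layer (suc t))))
        where
        ind-∨ : ∀ a b → ind (a ∨ b) ≤ ind a + ind b
        ind-∨ true  b = s≤s z≤n
        ind-∨ false b = ≤-refl

      -- Each edge is seen from its lower and from its upper end. Disjointness of the layers lets an
      -- ordered pair count in only one of these roles.
      twoLayers-degSum : 2 * layerEdges t ≤ degSum (layerGraph Λ t) twoLayers
      twoLayers-degSum = begin
        2 * layerEdges t
          ≡⟨ cong (layerEdges t +_) (+-identityʳ _) ⟩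
        layerEdges t + layerEdges t
          ≡⟨ cong (layerEdges t +_) (∑-comm (λ u v → ind (layerEdge t u v))) ⟩
        layerEdges t + sum (λ u → sum (λ v → ind (layerEdge t v u)))
          ≡⟨ ∑-distrib-+ (λ u → count (layerEdge t u)) _ ⟨
        sum (λ u → count (layerEdge t u) + sum (λ v → ind (layerEdge t v u)))
          ≡⟨ sum-cong-≗ (λ u → ≡.sym (∑-distrib-+ (λ v → ind (layerEdge t u v)) _)) ⟩
        sum (λ u → sum (λ v → ind (layerEdge t u v) + ind (layerEdge t v u)))
          ≤⟨ sum-mono (λ u → sum-mono (pointwise u)) ⟩
        sum (λ u → sum (λ v → ind (twoLayers u) * (ind (twoLayers v) * ind (adj (layerGraph Λ t) u v))))
          ≡⟨ sum-cong-≗ (λ u → *-distribˡ-sum (ind (twoLayers u)) (λ v → ind (twoLayers v) * ind (adj (layerGraph Λ t) u v))) ⟨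
        degSum (layerGraph Λ t) twoLayers ∎
        where
        open ≤-Reasoning
        not-both : ∀ v → layer t v ∧ layer (suc t) v ≡ false
        not-both v with layer (suc t) v in Lv
        ... | true  rewrite layer-suc-false Λ t Lv = refl
        ... | false with layer t v
        ...   | true  = refl
        ...   | false = refl
        by-cases : ∀ a b c d e → a ∧ b ≡ false → c ∧ d ≡ false →
          ind (a ∧ (d ∧ e)) + ind (c ∧ (b ∧ e)) ≤
          ind (a ∨ b) * (ind (c ∨ d) * ind (e ∧ ((a ∧ d) ∨ (b ∧ c))))
        by-cases true  false true  false e _ _ = z≤n
        by-cases true  false false true  true  _ _ = ≤-refl
        by-cases true  false false true  false _ _ = z≤n
        by-cases true  false false false e _ _ = z≤n
        by-cases false true  true  false true  _ _ = ≤-refl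
        by-cases false true  true  false false _ _ = z≤n
        by-cases false true  false true  e _ _ = z≤n
        by-cases false true  false false e _ _ = z≤n
        by-cases false false true  false e _ _ = z≤n
        by-cases false false false true  e _ _ = z≤n
        by-cases false false false false e _ _ = z≤n
        pointwise : ∀ u v → ind (layerEdge t u v) + ind (layerEdge t v u) ≤
          ind (twoLayers u) * (ind (twoLayers v) * ind (adj (layerGraph Λ t) u v))
        pointwise u v rewrite Graph.sym G v u =
          by-cases (layer t u) (layer (suc t) u) (layer t v) (layer (suc t) v) (adj G u v) (not-both u) (not-both v)

      dense⇒⊥ : 2 ≤ r → ¬ r * (layerSize t + layerSize (suc t)) < layerEdges t
      dense⇒⊥ 2≤r dense with dense⇒minDegree (layerGraph Λ t) r 1 twoLayers density
        where
        density : r * 2 * count twoLayers < 1 * degSum (layerGraph Λ t) twoLayers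
        density = begin-strict
          r * 2 * count twoLayers                         ≤⟨ *-monoʳ-≤ (r * 2) twoLayers-count ⟩
          r * 2 * (layerSize t + layerSize (suc t))       ≡⟨ regroup r _ ⟩
          2 * (r * (layerSize t + layerSize (suc t)))     <⟨ *-monoʳ-< 2 dense ⟩
          2 * layerEdges t                                ≤⟨ twoLayers-degSum ⟩
          degSum (layerGraph Λ t) twoLayers               ≡⟨ *-identityˡ _ ⟨
          1 * degSum (layerGraph Λ t) twoLayers           ∎
          where
          open ≤-Reasoning
          regroup : ∀ r x → r * 2 * x ≡ 2 * (r * x)
          regroup = solve-∀
      ... | T , (v , Tv) , min-deg
        with minDegree⇒chordedCycle (restrict (layerGraph Λ t) T) (λ v → T v ≡ true)
               (λ {u} uv → proj₂ (∧-true {T u} (proj₁ (∧-true uv)))) Tv 2≤r 1≤D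
               (λ {v} Tv → subst (r <_) (trans (*-identityˡ _) (deg-restrict (layerGraph Λ t) T v Tv)) (min-deg v Tv))
               (λ {m} m< → no-short m< ∘ HasCycle-mono {H = restrict (layerGraph Λ t) T} {G = G}
                 (layerGraph-⊆ Λ t ∘ restrict-⊆ (layerGraph Λ t) T))
      ...   | p , s , p≥ , C = chordedCycle⇒HasCycle-2k Λ t<k no-2k
        (record
          { c = ChordedCycle.c C
          ; periodic = ChordedCycle.periodic C
          ; edge = restrict-⊆ (layerGraph Λ t) T ∘ ChordedCycle.edge C
          ; distinct = ChordedCycle.distinct C
          ; chord = restrict-⊆ (layerGraph Λ t) T (ChordedCycle.chord C)
          ; 1<s = ChordedCycle.1<s C
          ; 1+s<p = ChordedCycle.1+s<p C
          })
        (≤-trans rD p≥)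

    layerEdges-sparse : layerEdges t ≤ r * (layerSize t + layerSize (suc t))
    layerEdges-sparse with m≤n⇒m<n∨m≡n 1≤r
    ... | inj₁ 2≤r  = ≮⇒≥ (dense⇒⊥ 2≤r)
    ... | inj₂ refl = ≤-trans (layerEdges≤layerSize no-short′)
      (≤-trans (m≤n+m _ (layerSize t)) (≤-reflexive (≡.sym (*-identityˡ _))))
      where
      -- The excluded length is `2 * (h + 2)` with `h + 2 ≤ k`. Equality is a cycle of length
      -- `2 * k`; anything less lies below `2 + D`, because `r = 1` gives `2 * k ≤ 2 + D`.
      no-short′ : ∀ {h} → h < t → ¬ HasCycle G (2 * suc h + 2)
      no-short′ {h} h<t cycle with m≤n⇒m<n∨m≡n (≤-trans (s≤s h<t) t<k)
      ... | inj₂ refl = no-2k (subst (HasCycle G) (trans (+-comm _ 2) (≡.sym (*-suc 2 (suc h)))) cycle)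
      ... | inj₁ h<k = no-short (<-≤-trans (subst (_< 2 * k) (trans (*-suc 2 (suc h)) (+-comm 2 _)) (*-monoʳ-< 2 h<k))
        (≤-trans rD (≤-reflexive (cong (2 +_) (*-identityˡ D))))) cycle

-- Growth of the layers

module _ (G : Graph n) (root : Fin n) where

  private
    ball : ℕ → Fin n → Bool
    ball-step? : ∀ t v → Dec (∃ λ u → ball t u ≡ true × Adj G u v)

    ball zero    v = ⌊ v ≟ root ⌋
    ball (suc t) v = ball t v ∨ ⌊ ball-step? t v ⌋

    ball-step? t v = any? λ u → (ball t u Bool.≟ true) ×-dec (adj G u v Bool.≟ true)

    sphere : ℕ → Fin n → Bool
    sphere zero    v = ball 0 v
    sphere (suc t) v = ball (suc t) v ∧ not (ball t v)

    ball-suc : ∀ t {v} → ball t v ≡ true → ball (suc t) v ≡ true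
    ball-suc t Bv rewrite Bv = refl

    ball-adj : ∀ t {u v} → ball t u ≡ true → Adj G u v → ball (suc t) v ≡ true
    ball-adj t {u} {v} Bu uv with ball t v | ball-step? t v
    ... | true  | _       = refl
    ... | false | yes _   = refl
    ... | false | no none = contradiction (u , Bu , uv) none

    ball-mono : ∀ {s t v} → s ≤ t → ball s v ≡ true → ball t v ≡ true
    ball-mono {t = zero}  z≤n  Bv = Bv
    ball-mono {t = suc t} s≤1+t Bv with m≤n⇒m<n∨m≡n s≤1+t
    ... | inj₂ refl      = Bv
    ... | inj₁ (s≤s s≤t) = ball-suc t (ball-mono s≤t Bv)

    sphere⇒ball : ∀ t {v} → sphere t v ≡ true → ball t v ≡ true
    sphere⇒ball zero    Sv = Sv
    sphere⇒ball (suc t) Sv = proj₁ (∧-true Sv)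

    not-true : ∀ {b} → not b ≡ true → b ≡ false
    not-true {false} _ = refl

    sphere-outside : ∀ {s t v} → s < t → sphere t v ≡ true → ball s v ≡ false
    sphere-outside {s} {suc t} {v} (s≤s s≤t) Sv with ball s v in Bv
    ... | false = refl
    ... | true  = contradiction
      (trans (≡.sym (ball-mono s≤t Bv)) (not-true (proj₂ (∧-true {ball (suc t) v} Sv)))) λ ()

    sphere-< : ∀ {s t v} → s < t → sphere s v ≡ true → ¬ sphere t v ≡ true
    sphere-< {s} s<t Ss St = contradiction (trans (≡.sym (sphere⇒ball s Ss)) (sphere-outside s<t St)) λ ()

    sphere-disjoint : ∀ {s t v} → sphere s v ≡ true → sphere t v ≡ true → s ≡ t
    sphere-disjoint {s} {t} Ss St with <-cmp s t
    ... | tri< s<t _ _ = contradiction St (sphere-< s<t Ss)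
    ... | tri≈ _ s≡t _ = s≡t
    ... | tri> _ _ t<s = contradiction Ss (sphere-< t<s St)

    ball⇒sphere : ∀ t {v} → ball t v ≡ true → ∃ λ s → s ≤ t × sphere s v ≡ true
    ball⇒sphere zero    Bv = 0 , z≤n , Bv
    ball⇒sphere (suc t) {v} Bv with ball t v in Btv
    ... | true  = let s , s≤t , Ss = ball⇒sphere t Btv in s , m≤n⇒m≤1+n s≤t , Ss
    ... | false = suc t , ≤-refl , ∧-intro (trans (cong (_∨ ⌊ ball-step? t v ⌋) Btv) Bv) (cong not Btv)

    -- The neighbour that put `v` into the ball cannot lie on an earlier sphere, since `v` would
    -- then have entered earlier.
    sphere-parent : ∀ t {v} → sphere (suc t) v ≡ true → ∃ λ u → sphere t u ≡ true × Adj G u v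
    sphere-parent t {v} Sv with ball t v in Btv | ball-step? t v
    sphere-parent t {v} Sv | true  | _ = contradiction Sv λ ()
    sphere-parent t {v} Sv | false | no _ = contradiction Sv λ ()
    sphere-parent t {v} Sv | false | yes (u , Bu , uv) with ball⇒sphere t Bu
    ... | s , s≤t , Su with m≤n⇒m<n∨m≡n s≤t
    ...   | inj₂ refl = u , Su , uv
    ...   | inj₁ s<t  = contradiction
      (trans (≡.sym (ball-mono s<t (ball-adj s (sphere⇒ball s Su) uv))) Btv) λ ()

    parent? : ∀ t v → Dec (∃ λ u → sphere t u ≡ true × Adj G u v)
    parent? t v = any? λ u → (sphere t u Bool.≟ true) ×-dec (adj G u v Bool.≟ true)

    choose : ∀ {v} {P : Fin n → Set} → Dec (∃ P) → Fin n
    choose     (yes (u , _)) = u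
    choose {v} (no _)        = v

    choose-spec : ∀ {v} {P : Fin n → Set} (d : Dec (∃ P)) → ∃ P → P (choose {v} d)
    choose-spec (yes (_ , Pu)) _ = Pu
    choose-spec (no none)      e = contradiction e none

  distanceLayering : Layering G
  distanceLayering = record
    { root         = root
    ; layer        = sphere
    ; layer-0      = λ {v} → at-root v
    ; disjoint     = sphere-disjoint
    ; parent       = λ t v → choose {v} (parent? t v)
    ; parent-layer = λ {t} {v} Sv → proj₁ (choose-spec {v} (parent? t v) (sphere-parent t Sv))
    ; parent-adj   = λ {t} {v} Sv → proj₂ (choose-spec {v} (parent? t v) (sphere-parent t Sv))
    }
    where
    at-root : ∀ v → sphere 0 v ≡ true → v ≡ root
    at-root v p with v ≟ root
    ... | yes eq = eq

  distanceLayering-root : Layering.layer distanceLayering 0 root ≡ true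
  distanceLayering-root with root ≟ root
  ... | yes _ = refl
  ... | no ≢  = contradiction refl ≢

  module _ (bipartite : Bipartite G) where

    private
      col = proj₁ bipartite
      colour : ℕ → Bool
      colour zero    = col root
      colour (suc t) = not (colour t)

      flip : ∀ {u v} → Adj G u v → col v ≡ not (col u)
      flip {u} {v} uv = ¬-not (proj₂ bipartite u v uv ∘ ≡.sym)

      sphere-colour : ∀ t {v} → sphere t v ≡ true → col v ≡ colour t
      sphere-colour zero    Sv = cong col (Layering.layer-0 distanceLayering Sv)
      sphere-colour (suc t) Sv with sphere-parent t Sv
      ... | u , Su , uv = trans (flip uv) (cong not (sphere-colour t Su))

    -- `v` enters the ball by step `t + 1`. Layer `t` is ruled out by the two-colouring, and a layer
    -- below `t - 1` would have pulled `u` in too early.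
    distanceLayering-neighbour : ∀ {t u v} → Layering.layer distanceLayering t u ≡ true → Adj G u v →
      Layering.layer distanceLayering (suc t) v ≡ true ⊎
      ∃ λ s → t ≡ suc s × Layering.layer distanceLayering s v ≡ true
    distanceLayering-neighbour {t} {u} {v} Su uv with ball⇒sphere (suc t) (ball-adj t (sphere⇒ball t Su) uv)
    ... | s , s≤1+t , Sv with m≤n⇒m<n∨m≡n s≤1+t
    ...   | inj₂ refl = inj₁ Sv
    ...   | inj₁ (s≤s s≤t) with m≤n⇒m<n∨m≡n s≤t
    ...     | inj₂ refl = contradiction (trans (sphere-colour t Sv) (≡.sym (sphere-colour t Su)))
                            (proj₂ bipartite u v uv ∘ ≡.sym)
    ...     | inj₁ s<t with m≤n⇒m<n∨m≡n s<t
    ...       | inj₂ refl = inj₂ (s , refl , Sv)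
    ...       | inj₁ 1+s<t = contradiction
      (trans (≡.sym (ball-adj s (sphere⇒ball s Sv) (Adj-sym G uv))) (sphere-outside 1+s<t Su)) λ ()

    private
      Λ = distanceLayering

      -- The zero case stands for the missing layer before the root and keeps the degree count
      -- uniform in `t`.
      previousEdge : ℕ → Fin n → Fin n → ℕ
      previousEdge zero    v u = 0
      previousEdge (suc t) v u = ind (layerEdge Λ t u v)

      previousEdges previousSize : ℕ → ℕ
      previousEdges zero    = 0
      previousEdges (suc t) = layerEdges Λ t
      previousSize zero    = 0
      previousSize (suc t) = layerSize Λ t

      sum-previousEdge : ∀ t → sum (λ v → sum (previousEdge t v)) ≡ previousEdges t
      sum-previousEdge zero    = sum-zero (λ v → sum (previousEdge zero v)) λ v → sum-zero (previousEdge zero v) λ _ → refl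
      sum-previousEdge (suc t) = ∑-comm (λ v u → ind (layerEdge Λ t u v))

      layer-degrees : ∀ t → sum (λ v → ind (sphere t v) * count (adj G v)) ≤ previousEdges t + layerEdges Λ t
      layer-degrees t = begin
        sum (λ v → ind (sphere t v) * count (adj G v))
          ≡⟨ sum-cong-≗ (λ v → *-distribˡ-sum (ind (sphere t v)) (ind ∘ adj G v)) ⟩
        sum (λ v → sum (λ u → ind (sphere t v) * ind (adj G v u)))
          ≤⟨ sum-mono (λ v → sum-mono (λ u → pointwise v u)) ⟩
        sum (λ v → sum (λ u → previousEdge t v u + ind (layerEdge Λ t v u)))
          ≡⟨ sum-cong-≗ (λ v → ∑-distrib-+ (previousEdge t v) (ind ∘ layerEdge Λ t v)) ⟩
        sum (λ v → sum (previousEdge t v) + count (layerEdge Λ t v))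
          ≡⟨ ∑-distrib-+ (λ v → sum (previousEdge t v)) (λ v → count (layerEdge Λ t v)) ⟩
        sum (λ v → sum (previousEdge t v)) + layerEdges Λ t
          ≡⟨ cong (_+ layerEdges Λ t) (sum-previousEdge t) ⟩
        previousEdges t + layerEdges Λ t ∎
        where
        open ≤-Reasoning
        one≤ : ∀ {b} → b ≡ true → 1 ≤ ind b
        one≤ refl = s≤s z≤n
        covered : ∀ t v u → sphere t v ≡ true → Adj G v u → 1 ≤ previousEdge t v u + ind (layerEdge Λ t v u)
        covered t v u Sv vu with distanceLayering-neighbour {t} Sv vu
        ... | inj₁ Su = m≤n⇒m≤o+n (previousEdge t v u) (one≤ (∧-intro Sv (∧-intro Su vu)))
        ... | inj₂ (s , refl , Su) = m≤n⇒m≤n+o _ (one≤ (∧-intro Su (∧-intro Sv (Adj-sym G vu))))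
        pointwise : ∀ v u → ind (sphere t v) * ind (adj G v u) ≤ previousEdge t v u + ind (layerEdge Λ t v u)
        pointwise v u = by-cases (sphere t v) (adj G v u) refl refl
          where
          by-cases : ∀ a b → sphere t v ≡ a → adj G v u ≡ b →
            ind a * ind b ≤ previousEdge t v u + ind (layerEdge Λ t v u)
          by-cases false b     _  _  = z≤n
          by-cases true  false _  _  = z≤n
          by-cases true  true  Sv vu = covered t v u Sv vu

    module _ {k r e : ℕ} (1≤r : 1 ≤ r) (1≤n : 1 ≤ n) (4rn≤e : 4 * r * n ≤ e)
             (min-deg : ∀ {t v} → Layering.layer distanceLayering t v ≡ true → e ≤ n * count (adj G v))
             (sparse : ∀ {t} → t < k → layerEdges Λ t ≤ r * (layerSize Λ t + layerSize Λ (suc t)))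
             where

      private
        size = layerSize Λ

        instance
          nr-nonZero : NonZero (n * r)
          nr-nonZero = >-nonZero (*-mono-≤ 1≤n 1≤r)

        degrees : ∀ t → e * size t ≤ n * (previousEdges t + layerEdges Λ t)
        degrees t = begin
          e * size t                                        ≡⟨ *-distribˡ-sum e (ind ∘ sphere t) ⟩
          sum (λ v → e * ind (sphere t v))                  ≤⟨ sum-mono pointwise ⟩
          sum (λ v → n * (ind (sphere t v) * count (adj G v))) ≡⟨ *-distribˡ-sum n (λ v → ind (sphere t v) * count (adj G v)) ⟨
          n * sum (λ v → ind (sphere t v) * count (adj G v))   ≤⟨ *-monoʳ-≤ n (layer-degrees t) ⟩
          n * (previousEdges t + layerEdges Λ t)            ∎
          where
          open ≤-Reasoning
          pointwise : ∀ v → e * ind (sphere t v) ≤ n * (ind (sphere t v) * count (adj G v))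
          pointwise v with sphere t v in Sv
          ... | false = ≤-trans (≤-reflexive (*-zeroʳ e)) z≤n
          ... | true  = ≤-trans (≤-reflexive (*-identityʳ e))
            (≤-trans (min-deg {t} Sv) (≤-reflexive (cong (n *_) (≡.sym (*-identityˡ _)))))

        previous-sparse : ∀ t → t ≤ k → previousEdges t ≤ r * (previousSize t + size t)
        previous-sparse zero    _   = z≤n
        previous-sparse (suc t) t<k = sparse t<k

      -- Sparseness on both sides of layer `t`, with its predecessor no larger, gives at most
      -- `r * (3 * size t + size (suc t))` edges. Comparison with `4 * r * n ≤ e` yields
      -- monotonicity, and monotonicity turns 3 + 1 into the factor 4. Both conclusions are proved
      -- together because the bound uses monotonicity one layer earlier.
      layers-grow : ∀ t → t < k → size t ≤ size (suc t) × e * size t ≤ 4 * r * n * size (suc t)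
      layers-grow t t<k = grows , (begin
        e * size t                             ≤⟨ upper ⟩
        n * r * (3 * size t + size (suc t))    ≤⟨ *-monoʳ-≤ (n * r) (+-monoˡ-≤ (size (suc t)) (*-monoʳ-≤ 3 grows)) ⟩
        n * r * (3 * size (suc t) + size (suc t)) ≡⟨ regroup n r (size (suc t)) ⟩
        4 * r * n * size (suc t)               ∎)
        where
        open ≤-Reasoning
        regroup : ∀ n r x → n * r * (3 * x + x) ≡ 4 * r * n * x
        regroup = solve-∀
        previous≤ : ∀ t → t < k → previousSize t ≤ size t
        previous≤ zero    _   = z≤n
        previous≤ (suc t) t<k = proj₁ (layers-grow t (<-trans (n<1+n t) t<k))
        upper : e * size t ≤ n * r * (3 * size t + size (suc t))
        upper = begin
          e * size t
            ≤⟨ degrees t ⟩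
          n * (previousEdges t + layerEdges Λ t)
            ≤⟨ *-monoʳ-≤ n (+-mono-≤ (previous-sparse t (<⇒≤ t<k)) (sparse t<k)) ⟩
          n * (r * (previousSize t + size t) + r * (size t + size (suc t)))
            ≤⟨ *-monoʳ-≤ n (+-monoˡ-≤ _ (*-monoʳ-≤ r (+-monoˡ-≤ (size t) (previous≤ t t<k)))) ⟩
          n * (r * (size t + size t) + r * (size t + size (suc t)))
            ≡⟨ collect n r (size t) (size (suc t)) ⟩
          n * r * (3 * size t + size (suc t)) ∎
          where
          collect : ∀ n r x y → n * (r * (x + x) + r * (x + y)) ≡ n * r * (3 * x + y)
          collect = solve-∀
        grows : size t ≤ size (suc t)
        grows = +-cancelˡ-≤ (3 * size t) _ _ (*-cancelˡ-≤ (n * r) (begin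
          n * r * (3 * size t + size t)        ≡⟨ regroup n r (size t) ⟩
          4 * r * n * size t                   ≤⟨ *-monoˡ-≤ (size t) 4rn≤e ⟩
          e * size t                           ≤⟨ upper ⟩
          n * r * (3 * size t + size (suc t))  ∎))

      layers-grow-power : ∀ t → t ≤ k → e ^ t ≤ (4 * r * n) ^ t * size t
      layers-grow-power zero    _   = ≤-trans (root-counted (distanceLayering-root)) (≤-reflexive (≡.sym (*-identityˡ (size 0))))
        where
        root-counted : sphere 0 root ≡ true → 1 ≤ size 0
        root-counted R = ≤-trans (≤-reflexive (cong ind (≡.sym R))) (term≤sum (ind ∘ sphere 0) root)
      layers-grow-power (suc t) t<k = begin
        e * e ^ t                       ≤⟨ *-monoʳ-≤ e (layers-grow-power t (<⇒≤ t<k)) ⟩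
        e * (m ^ t * size t)            ≡⟨ x∙yz≈y∙xz e (m ^ t) (size t) ⟩
        m ^ t * (e * size t)            ≤⟨ *-monoʳ-≤ (m ^ t) (proj₂ (layers-grow t t<k)) ⟩
        m ^ t * (m * size (suc t))      ≡⟨ *-assoc (m ^ t) m _ ⟨
        m ^ t * m * size (suc t)        ≡⟨ cong (_* size (suc t)) (*-comm (m ^ t) m) ⟩
        m * m ^ t * size (suc t)        ∎
        where
        open ≤-Reasoning
        m = 4 * r * n
        x∙yz≈y∙xz : ∀ x y z → x * (y * z) ≡ y * (x * z)
        x∙yz≈y∙xz = solve-∀

    last-layer<n : ∀ {k} → 1 ≤ k → layerSize Λ k < n
    last-layer<n {k} 1≤k = begin
      suc (layerSize Λ k)                                ≤⟨ +-monoˡ-≤ (layerSize Λ k) root-counted ⟩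
      layerSize Λ 0 + layerSize Λ k                      ≡⟨ ∑-distrib-+ (ind ∘ sphere 0) (ind ∘ sphere k) ⟨
      sum (λ v → ind (sphere 0 v) + ind (sphere k v))    ≤⟨ sum-mono at-most-one ⟩
      sum {n} (λ _ → 1)                                  ≡⟨ sum-const-1 n ⟩
      n                                                  ∎
      where
      open ≤-Reasoning
      root-counted : 1 ≤ layerSize Λ 0
      root-counted = ≤-trans (≤-reflexive (cong ind (≡.sym distanceLayering-root))) (term≤sum (ind ∘ sphere 0) root)
      at-most-one : ∀ v → ind (sphere 0 v) + ind (sphere k v) ≤ 1
      at-most-one v = by-cases (sphere 0 v) (sphere k v) refl refl
        where
        by-cases : ∀ a b → sphere 0 v ≡ a → sphere k v ≡ b → ind a + ind b ≤ 1
        by-cases true  true  S0 Sk = contradiction (sphere-disjoint {0} {k} {v} S0 Sk) (<⇒≢ 1≤k)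
        by-cases true  false _ _ = ≤-refl
        by-cases false true  _ _ = ≤-refl
        by-cases false false _ _ = z≤n

-- Decidability of cycles

-- The search rebuilds `f` from its head and tail, which recovers it only pointwise; hence `P` has
-- to respect pointwise equality.
any-function? : ∀ {m n} {P : (Fin m → Fin n) → Set} → (∀ {f g} → (∀ i → f i ≡ g i) → P f → P g) →
  (∀ f → Dec (P f)) → Dec (∃ P)
any-function? {zero} resp P? = map′ (empty ,_) (λ { (f , p) → resp {f} {empty} (λ ()) p }) (P? empty)
  where
  empty : Fin 0 → _
  empty ()
any-function? {suc m} {n} {P} resp P? = map′
  (λ { (x , f , p) → cons x f , p })
  (λ { (f , p) → f zero , f ∘ suc , resp (λ { zero → refl ; (suc i) → refl }) p })
  (any? λ x → any-function? (λ f≗g → resp λ { zero → refl ; (suc i) → f≗g i }) (P? ∘ cons x))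
  where
  cons : Fin n → (Fin m → Fin n) → Fin (suc m) → Fin n
  cons x f zero    = x
  cons x f (suc i) = f i

-- Licenses arguing from the absence of a cycle of length `2 * k`.
hasCycle? : (G : Graph n) → ∀ m → Dec (HasCycle G m)
hasCycle? {n} G m = (3 ≤? m) ×-dec any-function? resp λ c →
  map′ (λ inj {i} {j} → inj i j) (λ inj i j → inj {i} {j})
       (all? λ i → all? λ j → (c i ≟ c j) →-dec (i ≟ j))
  ×-dec (all? λ i → all? λ j →
    ((toℕ j ℕ.≟ suc (toℕ i)) ⊎-dec ((toℕ i ℕ.≟ m ∸ 1) ×-dec (toℕ j ℕ.≟ 0)))
    →-dec (adj G (c i) (c j) Bool.≟ true))
  where
  resp : ∀ {c d : Fin m → Fin n} → (∀ i → c i ≡ d i) →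
    (Injective _≡_ _≡_ c × (∀ i j → (toℕ j ≡ suc (toℕ i) ⊎ (toℕ i ≡ m ∸ 1 × toℕ j ≡ 0)) → Adj G (c i) (c j))) →
    Injective _≡_ _≡_ d × (∀ i j → (toℕ j ≡ suc (toℕ i) ⊎ (toℕ i ≡ m ∸ 1 × toℕ j ≡ 0)) → Adj G (d i) (d j))
  resp c≗d (c-inj , c-adj) =
    (λ {i} {j} eq → c-inj (trans (c≗d i) (trans eq (≡.sym (c≗d j))))) ,
    λ i j next → ≡.subst₂ (Adj G) (c≗d i) (c≗d j) (c-adj i j next)

-- Ceilings, powers and the final estimate

≤⌈/⌉* : ∀ a b → 1 ≤ b → a ≤ ⌈ a / b ⌉ * b
≤⌈/⌉* a (suc b) _ = +-cancelˡ-≤ b _ _ (begin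
  b + a                                            ≡⟨ +-comm b a ⟩
  a + b                                            ≡⟨ m≡m%n+[m/n]*n (a + b) (suc b) ⟩
  (a + b) % suc b + ((a + b) / suc b) * suc b      ≤⟨ +-monoˡ-≤ _ (≤-pred (m%n<n (a + b) (suc b))) ⟩
  b + ((a + b) / suc b) * suc b                    ∎)
  where open ≤-Reasoning

*-^ : ∀ a b k → (a * b) ^ k ≡ a ^ k * b ^ k
*-^ a b zero    = refl
*-^ a b (suc k) = trans (cong (a * b *_) (*-^ a b k)) (interchange a b (a ^ k) (b ^ k))
  where
  interchange : ∀ a b x y → a * b * (x * y) ≡ a * x * (b * y)
  interchange = solve-∀

-- Monotonicity of the k-th power, applied to the contrapositive, stands in for a root. One factor
-- `n` is given away here.
density⇒4rn≤e : ∀ {k r e n} → 1 ≤ k → 1 ≤ n → (4 * r) ^ k * n ^ (k + 1) ≤ e ^ k → 4 * r * n ≤ e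
density⇒4rn≤e {k} {r} {e} {n} 1≤k 1≤n dense = ≮⇒≥ λ e<4rn → <⇒≱ (^-monoˡ-< k {{>-nonZero 1≤k}} e<4rn) (begin
  (4 * r * n) ^ k              ≡⟨ *-^ (4 * r) n k ⟩
  (4 * r) ^ k * n ^ k          ≤⟨ *-monoʳ-≤ ((4 * r) ^ k) (^-monoʳ-≤ n {{>-nonZero 1≤n}} (m≤m+n k 1)) ⟩
  (4 * r) ^ k * n ^ (k + 1)    ≤⟨ dense ⟩
  e ^ k                        ∎)
  where open ≤-Reasoning

-- The bound on the number of edges is raised to the k-th power, which removes the exponent 1 + 1/k
-- and keeps it in ℕ.
theorem9 : (k : ℕ) → k ≥ 2 → (n : ℕ) → (G : Graph n) → Bipartite G →
    (g : ℕ) → Girth G g →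
    (4 * ⌈ (2 * (k ∸ 1)) / (g ∸ 2) ⌉) ^ k * n ^ (k + 1) ≤ edgeCount G ^ k →
    HasCycle G (2 * k)
theorem9 k k≥2 n G (col , proper) g ((3≤g , c , _) , no-short) dense =
  decidable-stable (hasCycle? G (2 * k)) contradictory
  where
  D = g ∸ 2
  r = ⌈ (2 * (k ∸ 1)) / D ⌉
  e = edgeCount G

  1≤D : 1 ≤ D
  1≤D = ∸-monoˡ-≤ 2 3≤g
  1≤k : 1 ≤ k
  1≤k = ≤-trans (s≤s z≤n) k≥2
  1≤n : 1 ≤ n
  1≤n = inhabited (c (fromℕ< 3≤g))
    where
    inhabited : ∀ {n} → Fin n → 1 ≤ n
    inhabited zero    = s≤s z≤n
    inhabited (suc _) = s≤s z≤n
  2[k-1]≤rD : 2 * (k ∸ 1) ≤ r * D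
  2[k-1]≤rD = ≤⌈/⌉* (2 * (k ∸ 1)) D 1≤D
  2k≤2+rD : 2 * k ≤ 2 + r * D
  2k≤2+rD = ≤-trans (≤-reflexive (trans (cong (2 *_) (≡.sym (m+[n∸m]≡n 1≤k))) (*-distribˡ-+ 2 1 (k ∸ 1))))
    (+-monoʳ-≤ 2 2[k-1]≤rD)
  1≤r : 1 ≤ r
  1≤r = positive r (≤-trans (s≤s z≤n) (≤-trans (*-monoʳ-≤ 2 (∸-monoˡ-≤ 1 k≥2)) 2[k-1]≤rD))
    where
    positive : ∀ r → 1 ≤ r * D → 1 ≤ r
    positive (suc r) _ = s≤s z≤n
  4rn≤e : 4 * r * n ≤ e
  4rn≤e = density⇒4rn≤e {k} {r} 1≤k 1≤n dense
  1≤e : 1 ≤ e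
  1≤e = ≤-trans (*-mono-≤ (*-mono-≤ {1} {4} (s≤s z≤n) 1≤r) 1≤n) 4rn≤e

  -- The minimum degree is wanted as `e ≤ n * deg`, that is `e ∸ 1 < n * deg`. Using `e ∸ 1` also
  -- makes the density, which is `2 * e` over `n` by double counting, strict.
  all-degrees : (e ∸ 1) * 2 * count {n} (λ _ → true) < n * degSum G (λ _ → true)
  all-degrees = begin-strict
    (e ∸ 1) * 2 * count {n} (λ _ → true)   ≡⟨ cong ((e ∸ 1) * 2 *_) (sum-const-1 n) ⟩
    (e ∸ 1) * 2 * n                        <⟨ *-monoˡ-< n {{>-nonZero 1≤n}} (*-monoˡ-< 2 (≤-reflexive (m+[n∸m]≡n 1≤e))) ⟩
    e * 2 * n                              ≡⟨ trans (*-comm (e * 2) n) (cong (n *_) (*-comm e 2)) ⟩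
    n * (2 * e)                            ≡⟨ cong (n *_) (2*edgeCount G) ⟩
    n * sum (λ v → count (adj G v))        ≡⟨ cong (n *_) (sum-cong-≗ λ v → trans (*-identityˡ (deg G (λ _ → true) v))
                                                                   (sum-cong-≗ λ u → *-identityˡ (ind (adj G v u)))) ⟨
    n * degSum G (λ _ → true)              ∎
    where open ≤-Reasoning

  contradictory : ¬ ¬ HasCycle G (2 * k)
  contradictory no-2k with dense⇒minDegree G (e ∸ 1) n (λ _ → true) all-degrees
  ... | T , (root , T-root) , min-deg = <⇒≱ (last-layer<n H root H-bipartite 1≤k) n≤last
    where
    H = restrict G T
    H⊆G : H ⊆ᴳ G
    H⊆G = restrict-⊆ G T
    H-bipartite : Bipartite H
    H-bipartite = col , λ u v uv → proper u v (H⊆G uv)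
    Λ = distanceLayering H root
    open Layering Λ using (layer; layer-0; parent-adj)
    -- Layers do not leave `T`: the root lies in it, and any other layer vertex has a parent edge in
    -- `H`, whose ends are in `T`.
    in-T : ∀ {t v} → layer t v ≡ true → T v ≡ true
    in-T {zero}  Lv = subst (λ v → T v ≡ true) (≡.sym (layer-0 Lv)) T-root
    in-T {suc t} {v} Lv = proj₂ (∧-true {T (Layering.parent Λ t v)} (proj₁ (∧-true (parent-adj {t} Lv))))
    H-degree : ∀ {t v} → layer t v ≡ true → e ≤ n * count (adj H v)
    H-degree {t} {v} Lv = ≤-trans (≤-reflexive (≡.sym (m+[n∸m]≡n 1≤e)))
      (subst (λ d → e ∸ 1 < n * d) (deg-restrict G T v (in-T {t} Lv)) (min-deg v (in-T {t} Lv)))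
    sparse : ∀ {t} → t < k → layerEdges Λ t ≤ r * (layerSize Λ t + layerSize Λ (suc t))
    sparse t<k = layerEdges-sparse Λ 1≤r 1≤D 2k≤2+rD t<k
      (no-2k ∘ HasCycle-mono {H = H} {G = G} H⊆G)
      (λ {m} m<g → no-short m (subst (m <_) (m+[n∸m]≡n (≤-trans (s≤s (s≤s z≤n)) 3≤g)) m<g)
                   ∘ HasCycle-mono {H = H} {G = G} H⊆G)
    -- The exponent `k + 1` in the hypothesis is one more than the growth of the layers consumes;
    -- the surplus factor `n` becomes the bound.
    n≤last : n ≤ layerSize Λ k
    n≤last = *-cancelˡ-≤ ((4 * r) ^ k * n ^ k) {{>-nonZero positive}} (begin
      (4 * r) ^ k * n ^ k * n                ≡⟨ *-assoc ((4 * r) ^ k) (n ^ k) n ⟩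
      (4 * r) ^ k * (n ^ k * n)              ≡⟨ cong (λ z → (4 * r) ^ k * (n ^ k * z)) (^-identityʳ n) ⟨
      (4 * r) ^ k * (n ^ k * n ^ 1)          ≡⟨ cong ((4 * r) ^ k *_) (^-distribˡ-+-* n k 1) ⟨
      (4 * r) ^ k * n ^ (k + 1)              ≤⟨ dense ⟩
      e ^ k                                  ≤⟨ layers-grow-power H root H-bipartite {k} 1≤r 1≤n 4rn≤e (λ {t} → H-degree {t}) sparse k ≤-refl ⟩
      (4 * r * n) ^ k * layerSize Λ k        ≡⟨ cong (_* layerSize Λ k) (*-^ (4 * r) n k) ⟩
      (4 * r) ^ k * n ^ k * layerSize Λ k    ∎)
      where
      open ≤-Reasoning
      positive : 1 ≤ (4 * r) ^ k * n ^ k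
      positive = *-mono-≤ (m^n>0 (4 * r) {{>-nonZero (*-mono-≤ {1} {4} (s≤s z≤n) 1≤r)}} k) (m^n>0 n {{>-nonZero 1≤n}} k)
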